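{- Suppose $\pi\in\mathfrak S_k$. (a) $\textsf{sup-mesh}(\pi)$ is minimized (among all permutations in $\mathfrak S_k$) if and only if $|\pi(i)-\pi(i+1)|=1$ for all $1\le i<k$; that is, if and only if $\pi=123\cdots k$ or $\pi=k\cdots321$. (b) $\textsf{sup-mesh}(\pi)$ is maximized (among all permutations in $\mathfrak S_k$) if and only if $|\pi(i)-\pi(i+1)|\neq1$ for all $1\le i<k$; that is, there are maximally many ($2k$) enclosed diagonals to avoid.
   Context: Permutations: $\mathfrak S_n$ is the set of permutations of $[n]=\{1,\ldots,n\}$, $n\ge 1$, written in one-line notation. The graph of $\pi\in\mathfrak S_k$ is $G(\pi)=\{(i,\pi(i)):1\le i\le k\}$. Classical patterns: an occurrence of $\pi\in\mathfrak S_k$ in $\sigma\in\mathfrak S_n$ is a choice of indices $i_1<\cdots<i_k$ in $[n]$ such that $\sigma(i_1)\cdots\sigma(i_k)$ is in the same relative order as $\pi(1)\cdots\pi(k)$. The permutation $\sigma$ contains $\pi$ if there is an occurrence of $\pi$ in $\sigma$, and avoids $\pi$ otherwise (in particular if $n<k$). Mesh patterns: a mesh pattern is a pair $(\pi,R)$ with $\pi\in\mathfrak S_k$ and $R\subseteq\{0,\ldots,k\}^2$ (the mesh); the element $(a,b)\in R$ represents the unit square $[a,a+1]\times[b,b+1]$. A permutation $\sigma\in\mathfrak S_n$ contains $(\pi,R)$ if there is an occurrence $i_1<\cdots<i_k$ of $\pi$ in $\sigma$ such that the following holds. Let $v_1<\cdots<v_k$ be the values $\sigma(i_1),\ldots,\sigma(i_k)$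 in increasing order, and set $i_0=v_0=0$, $i_{k+1}=v_{k+1}=n+1$. Then for every $(a,b)\in R$ there is no $t\in[n]$ with $i_a<t<i_{a+1}$ and $v_b<\sigma(t)<v_{b+1}$. Otherwise $\sigma$ avoids $(\pi,R)$. For a (classical or mesh) pattern $p$, $\mathrm{Av}(p)$ is the set of all permutations (of all sizes $n\ge1$) that avoid $p$. A mesh $R\subseteq\{0,\ldots,k\}^2$ is superfluous for $\pi\in\mathfrak S_k$ if $\mathrm{Av}((\pi,R))=\mathrm{Av}(\pi)$. $\textsf{sup-mesh}(\pi)$ denotes the number of meshes $R\subseteq\{0,\ldots,k\}^2$ that are superfluous for $\pi$. Enclosed diagonals: an enclosed diagonal of $(\pi,R)$ is a diagonal chain of $h\ge1$ squares of $R$, each meeting the next in a corner, such that the $h-1$ corners shared by successive squares all belong to $G(\pi)$, while the two extreme corners of the chain do not belong to $G(\pi)$. Explicitly, it is either an increasing chain of squares $(i+x,j+x)\in R$ for $0\le x<h$, with $(i+x,j+x)\in G(\pi)$ for $1\le x<h$ and $(i,j),(i+h,j+h)\notin G(\pi)$; or a decreasing chain of squares $(i+x,j-x)\in R$ for $0\le x<h$, with $(i+x,j+1-x)\in G(\pi)$ for $1\le x<h$ and $(i,j+1),(i+h,j+1-h)\notin G(\pi)$. For a mesh to be superfluous it is necessary and sufficient that there be no enclosed diagonals. In (b), "enclosed diagonals to avoid" refers to the chains with $h\ge2$ squares in $\{0,\ldots,k\}^2$ that satisfy the conditions on $G(\pi)$ above, i.e. that would be enclosed diagonals if all of their squares were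 in the mesh (squares with no corner in $G(\pi)$, the case $h=1$, being excluded from the mesh beforehand).
   Formalization: In (b), the implication "sup-mesh(π) maximized ⇒ |π(i)−π(i+1)| ≠ 1 for all i" is stated only for k other than 2 and 3; for k = 2, 3 every permutation has a step equal to 1, so that implication is false there. -}

module Defs where

open import Data.Fin.Base using (Fin; toℕ; fromℕ; inject₁)
import Data.Fin.Base as Fin
open import Data.Fin.Permutation using (Permutation′; _⟨$⟩ʳ_; _⟨$⟩ˡ_)
open import Data.Fin.Subset using (Subset)
import Data.Fin.Subset as Subset
open import Data.List.Base using (List; length)
open import Data.List.Membership.Propositional using (_∈_)
open import Data.List.Relation.Unary.Unique.Propositional using (Unique)
open import Data.Nat.Base using (ℕ; suc; _+_; _∸_; _≤_; _<_; ∣_-_∣; NonZero)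
open import Data.Product.Base using (Σ; ∃; ∃-syntax; _×_; _,_)
open import Data.Vec.Base using (Vec; lookup)
import Data.Vec.Functional as Vector
open import Function.Bundles using (_⇔_)
open import Relation.Binary.PropositionalEquality.Core using (_≡_; _≢_)
open import Relation.Nullary.Negation.Core using (¬_)

private
  variable
    k n : ℕ

-- The index i : Fin k stands for the position (or value) toℕ i + 1 of [k].
-- Coordinates of type ℕ below are the usual 1-based ones.

Graph : Permutation′ k → ℕ → ℕ → Set
Graph {k} π x y =
  ∃[ i ] (x ≡ suc (toℕ {k} i)) × (y ≡ suc (toℕ (π ⟨$⟩ʳ i)))

record Occurrence (π : Permutation′ k) (σ : Permutation′ n) : Set where
  field
    index      : Fin k → Fin n
    increasing : ∀ {a b} → a Fin.< b → index a Fin.< index b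
    same-order : ∀ a b →
      (π ⟨$⟩ʳ a Fin.< π ⟨$⟩ʳ b) ⇔ (σ ⟨$⟩ʳ index a Fin.< σ ⟨$⟩ʳ index b)

Contains : Permutation′ k → Permutation′ n → Set
Contains π σ = Occurrence π σ

Avoids : Permutation′ k → Permutation′ n → Set
Avoids π σ = ¬ Contains π σ

-- A mesh is a subset of {0,…,k}², stored column by column.
Mesh : ℕ → Set
Mesh k = Vec (Subset (suc k)) (suc k)

_∈ᴹ_ : Fin (suc k) × Fin (suc k) → Mesh k → Set
(a , b) ∈ᴹ R = b Subset.∈ lookup R a

-- For u : Fin k → Fin n, listing u₁, …, u_k, this is the sequence
-- 0, u₁, …, u_k, n + 1 of 1-based coordinates.
framed : (Fin k → Fin n) → Fin (suc (suc k)) → ℕ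
framed {k} {n} u =
  0 Vector.∷ Vector.insertAt (λ j → suc (toℕ (u j))) (fromℕ k) (suc n)

module _ {π : Permutation′ k} {σ : Permutation′ n} (o : Occurrence π σ) where
  open Occurrence o

  positionLine : Fin (suc (suc k)) → ℕ
  positionLine = framed index

  -- Since σ ∘ index is ordered like π, its b-th smallest value is attained
  -- at π⁻¹ b.
  valueLine : Fin (suc (suc k)) → ℕ
  valueLine = framed (λ b → σ ⟨$⟩ʳ index (π ⟨$⟩ˡ b))

  InSquare : Fin (suc k) → Fin (suc k) → Fin n → Set
  InSquare a b t =
    (positionLine (inject₁ a) < suc (toℕ t)) ×
    (suc (toℕ t) < positionLine (Fin.suc a)) ×
    (valueLine (inject₁ b) < suc (toℕ (σ ⟨$⟩ʳ t))) ×
    (suc (toℕ (σ ⟨$⟩ʳ t)) < valueLine (Fin.suc b))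

ContainsMesh : Permutation′ k → Mesh k → Permutation′ n → Set
ContainsMesh π R σ =
  Σ (Occurrence π σ) λ o → ∀ a b → (a , b) ∈ᴹ R → ¬ (∃ λ t → InSquare o a b t)

AvoidsMesh : Permutation′ k → Mesh k → Permutation′ n → Set
AvoidsMesh π R σ = ¬ ContainsMesh π R σ

-- Av((π,R)) = Av(π), as sets of permutations of all sizes n ≥ 1.
Superfluous : Permutation′ k → Mesh k → Set
Superfluous π R =
  ∀ n .{{_ : NonZero n}} (σ : Permutation′ n) → AvoidsMesh π R σ ⇔ Avoids π σ

-- Exactly m elements of A satisfy P.
HasCount : {A : Set} → (A → Set) → ℕ → Set
HasCount {A} P m =
  Σ (List A) λ xs → Unique xs × (∀ x → x ∈ xs ⇔ P x) × length xs ≡ m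

-- sup-mesh(π) = m.  This is a relation because Superfluous quantifies over
-- permutations of all sizes, so it is not decidable by its form alone.
SupMesh : Permutation′ k → ℕ → Set
SupMesh π = HasCount (Superfluous π)

-- The numbers sup-mesh(π) and sup-mesh(τ) are required to exist, so neither
-- notion can hold vacuously.
SupMeshMinimized : Permutation′ k → Set
SupMeshMinimized {k} π =
  ∃[ m ] SupMesh π m × (∀ (τ : Permutation′ k) → ∃[ m′ ] SupMesh τ m′ × m ≤ m′)

SupMeshMaximized : Permutation′ k → Set
SupMeshMaximized {k} π =
  ∃[ m ] SupMesh π m × (∀ (τ : Permutation′ k) → ∃[ m′ ] SupMesh τ m′ × m′ ≤ m)

step : (π : Permutation′ k) (i j : Fin k) → ℕ
step π i j = ∣ toℕ (π ⟨$⟩ʳ i) - toℕ (π ⟨$⟩ʳ j) ∣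

AllStepsOne : Permutation′ k → Set
AllStepsOne {k} π = ∀ (i j : Fin k) → toℕ j ≡ suc (toℕ i) → step π i j ≡ 1

NoStepOne : Permutation′ k → Set
NoStepOne {k} π = ∀ (i j : Fin k) → toℕ j ≡ suc (toℕ i) → step π i j ≢ 1

data Direction : Set where
  increasing decreasing : Direction

-- A chain of `size` squares, identified by the lower left corners of the
-- squares, whose leftmost square is (col , row).
record Chain : Set where
  constructor chain
  field
    direction    : Direction
    col row size : ℕ

-- Chains of at least two squares of {0,…,k}² that are enclosed diagonals as
-- soon as all their squares are in the mesh.  The condition x ≤ j keeps the
-- truncated subtractions exact.
DiagonalToAvoid : Permutation′ k → Chain → Set
DiagonalToAvoid {k} π (chain increasing i j h) =
  2 ≤ h ×
  (∀ x → x < h → i + x ≤ k × j + x ≤ k) ×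
  (∀ x → 1 ≤ x → x < h → Graph π (i + x) (j + x)) ×
  ¬ Graph π i j ×
  ¬ Graph π (i + h) (j + h)
DiagonalToAvoid {k} π (chain decreasing i j h) =
  2 ≤ h ×
  (∀ x → x < h → i + x ≤ k × x ≤ j × j ∸ x ≤ k) ×
  (∀ x → 1 ≤ x → x < h → Graph π (i + x) (suc j ∸ x)) ×
  ¬ Graph π i (suc j) ×
  ¬ Graph π (i + h) (suc j ∸ h)

DiagonalsToAvoid : Permutation′ k → ℕ → Set
DiagonalsToAvoid π = HasCount (DiagonalToAvoid π)

{-# OPTIONS --safe #-}
module Submission where

-- Every graph point of π has four adjacent squares, two on each diagonal.  A
-- mesh is superfluous exactly if it arises by letting each point shade at most
-- one of its two squares in each direction.  Such a mesh is superfluous because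
-- an occurrence with a point in a shaded square can be moved onto that point,
-- and some weighted sum of coordinates decreases.  Conversely, insert a point
-- into a square of π: the occurrences of π in the result are the deletions of
-- the points of one monotone run of consecutive points, so the squares of the
-- corresponding diagonal cannot all lie in a superfluous mesh.
--
-- The squares shaded in one direction are therefore counted by words of length
-- k over three letters with a restriction at each i for which π(i), π(i + 1) is
-- a step of that direction; sup-mesh(π) is the product of the two counts, each
-- computed by a recursion along the word.  A step of size one lowers exactly one
-- of the counts; the product is largest when no step has size one and smallest when
-- all do.

open import Defs
open import Data.Bool.Base using (Bool; true; false; not; _∧_; if_then_else_)
open import Data.Empty using (⊥; ⊥-elim)
open import Data.Fin.Base using (Fin; zero; suc; toℕ; fromℕ; inject₁; punchIn; punchOut; opposite)
import Data.Fin.Base as Fin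
open import Data.Fin.Permutation using (Permutation′; _≈_; id; reverse; _⟨$⟩ʳ_; _⟨$⟩ˡ_; _∘ₚ_; insert; insert-punchIn; inverseˡ; inverseʳ)
open import Data.Fin.Induction using (<-weakInduction)
import Data.Fin.Properties as Finₚ
import Data.Fin.Subset.Properties as Subsetₚ
open import Data.List.Base as List using (List; []; _∷_; _++_; length; filter; cartesianProduct; allFin)
open import Data.List.Membership.Propositional using (_∈_; lose)
open import Data.List.Membership.Propositional.Properties using (∈-map⁺; ∈-map⁻; ∈-++⁺ˡ; ∈-++⁺ʳ; ∈-++⁻; ∈-cartesianProduct⁺; ∈-cartesianProduct⁻; ∈-filter⁺; ∈-filter⁻; ∈-allFin)
open import Data.List.Membership.Propositional.Properties.WithK using (unique∧set⇒bag)
open import Data.List.Relation.Binary.BagAndSetEquality using (∼bag⇒↭)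
open import Data.List.Relation.Binary.Permutation.Propositional.Properties using (↭-length)
import Data.List.Properties as Listₚ
import Data.List.Relation.Unary.All as All
open import Data.List.Relation.Unary.Any using (here)
open import Data.List.Relation.Unary.AllPairs using ([]; _∷_)
open import Data.List.Relation.Unary.All using ([]; _∷_)
open import Data.List.Relation.Unary.Unique.Propositional using (Unique)
import Data.List.Relation.Unary.Unique.Propositional.Properties as Unique
open import Data.Nat.Base using (ℕ; zero; suc; _+_; _*_; _∸_; _≤_; _<_; z≤n; s≤s; s≤s⁻¹; ∣_-_∣; NonZero; >-nonZero)
import Data.Nat.Properties as ℕ
open import Data.Nat.Induction using (<-wellFounded)
open import Data.Nat.Solver using (module +-*-Solver)
open import Data.Product.Base using (∃; ∃-syntax; _×_; _,_; proj₁; proj₂)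
open import Data.Sum.Base using (_⊎_; inj₁; inj₂; [_,_])
import Data.Sum.Base as Sum
open import Data.Vec.Base using (Vec; []; _∷_; lookup; tabulate)
open import Data.Fin.Relation.Unary.Top using (view; ‵fromℕ; ‵inject₁)
import Data.Vec.Properties as Vecₚ
import Data.Vec.Functional as Vector
import Data.Vec.Functional.Properties as Vectorₚ
open import Function.Base using (_∘_; case_of_)
open import Function.Bundles using (_⇔_; mk⇔; module Equivalence)
open import Function.Properties.Equivalence using () renaming (sym to ⇔-sym; trans to ⇔-trans)
open import Induction.WellFounded using (Acc; acc)
import Data.Product.Properties as Product
open import Relation.Binary.Definitions using (tri<; tri≈; tri>)
open import Relation.Binary.PropositionalEquality.Core using (_≡_; _≢_; refl; sym; trans; cong; cong₂; subst; subst₂)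
open import Relation.Nullary.Decidable using (toSum; Dec; yes; no; does; _×-dec_; _⊎-dec_; map′; ¬?; dec-true; dec-false)
open import Relation.Nullary.Negation.Core using (¬_; contradiction)
open Equivalence using (to; from)

private
  variable
    A B : Set
    k m n : ℕ

-- Counting by duplicate-free lists

hasCount-unique : {P : A → Set} → HasCount P m → HasCount P n → m ≡ n
hasCount-unique (xs , xs! , ∈xs⇔P , refl) (ys , ys! , ∈ys⇔P , refl) =
  ↭-length (∼bag⇒↭ (unique∧set⇒bag xs! ys! λ {x} → ⇔-trans (∈xs⇔P x) (⇔-sym (∈ys⇔P x))))

hasCount-cong : {P Q : A → Set} → (∀ x → P x ⇔ Q x) → HasCount P m → HasCount Q m
hasCount-cong P⇔Q (xs , xs! , ∈xs⇔P , len) = xs , xs! , (λ x → ⇔-trans (∈xs⇔P x) (P⇔Q x)) , len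

hasCount-none : {P : A → Set} → (∀ x → ¬ P x) → HasCount P 0
hasCount-none ¬P = [] , [] , (λ x → mk⇔ (λ ()) λ Px → contradiction Px (¬P x)) , refl

-- The maps need to be inverse only between `P` and `Q`, which suits `encode`: it is not injective
-- on all pairs of words. The image list has no duplicates because `d` maps it back to the
-- duplicate-free `xs`.
hasCount-transfer : {P : A → Set} {Q : B → Set} (e : A → B) (d : B → A) →
  (∀ x → P x → Q (e x)) → (∀ x → P x → d (e x) ≡ x) →
  (∀ y → Q y → P (d y)) → (∀ y → Q y → e (d y) ≡ y) →
  HasCount P m → HasCount Q m
hasCount-transfer {Q = Q} e d eP de dQ ed (xs , xs! , ∈xs⇔P , len) =
  List.map e xs ,
  Unique.map⁻ {f = d} (subst Unique (sym map-de) xs!) ,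
  (λ y → mk⇔
    (λ y∈ → let x , x∈ , eq = ∈-map⁻ e y∈ in subst Q (sym eq) (eP x (to (∈xs⇔P x) x∈)))
    λ Qy → subst (_∈ List.map e xs) (ed y Qy) (∈-map⁺ e (from (∈xs⇔P (d y)) (dQ y Qy)))) ,
  trans (Listₚ.length-map e xs) len
  where
  map-de : List.map d (List.map e xs) ≡ xs
  map-de = trans (sym (Listₚ.map-∘ xs))
    (Listₚ.map-id-local (All.tabulate λ {x} x∈ → de x (to (∈xs⇔P x) x∈)))

hasCount-image : {P : A → Set} (f : A → B) → (∀ {x y} → f x ≡ f y → x ≡ y) →
  HasCount P m → HasCount (λ y → ∃ λ x → P x × y ≡ f x) m
hasCount-image f f-injective (xs , xs! , ∈xs⇔P , len) =
  List.map f xs , Unique.map⁺ f-injective xs! ,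
  (λ y → mk⇔
    (λ y∈ → let x , x∈ , eq = ∈-map⁻ f y∈ in x , to (∈xs⇔P x) x∈ , eq)
    λ { (x , Px , refl) → ∈-map⁺ f (from (∈xs⇔P x) Px) }) ,
  trans (Listₚ.length-map f xs) len

hasCount-⊎ : {P Q : A → Set} → (∀ x → P x → ¬ Q x) →
  HasCount P m → HasCount Q n → HasCount (λ x → P x ⊎ Q x) (m + n)
hasCount-⊎ P⇒¬Q (xs , xs! , ∈xs⇔P , refl) (ys , ys! , ∈ys⇔Q , refl) =
  xs ++ ys ,
  Unique.++⁺ xs! ys! (λ (v∈xs , v∈ys) → P⇒¬Q _ (to (∈xs⇔P _) v∈xs) (to (∈ys⇔Q _) v∈ys)) ,
  (λ x → mk⇔
    (λ x∈ → Sum.map (to (∈xs⇔P x)) (to (∈ys⇔Q x)) (∈-++⁻ xs x∈))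
    [ ∈-++⁺ˡ ∘ from (∈xs⇔P x) , ∈-++⁺ʳ xs ∘ from (∈ys⇔Q x) ]) ,
  Listₚ.length-++ xs

length-cartesianProduct : (xs : List A) (ys : List B) →
  length (cartesianProduct xs ys) ≡ length xs * length ys
length-cartesianProduct []       ys = refl
length-cartesianProduct (x ∷ xs) ys = trans (Listₚ.length-++ (List.map (x ,_) ys))
  (cong₂ _+_ (Listₚ.length-map (x ,_) ys) (length-cartesianProduct xs ys))

hasCount-× : {P : A → Set} {Q : B → Set} →
  HasCount P m → HasCount Q n → HasCount (λ (x , y) → P x × Q y) (m * n)
hasCount-× (xs , xs! , ∈xs⇔P , refl) (ys , ys! , ∈ys⇔Q , refl) =
  cartesianProduct xs ys , Unique.cartesianProduct⁺ xs! ys! ,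
  (λ (x , y) → mk⇔
    (λ xy∈ → let x∈ , y∈ = ∈-cartesianProduct⁻ xs ys xy∈ in to (∈xs⇔P x) x∈ , to (∈ys⇔Q y) y∈)
    λ (Px , Qy) → ∈-cartesianProduct⁺ (from (∈xs⇔P x) Px) (from (∈ys⇔Q y) Qy)) ,
  length-cartesianProduct xs ys

-- Canonical words

-- The i-th letter says that the i-th point of π shades its lower square (lo),
-- its upper square (hi) or neither (none) along a fixed diagonal direction.

data Letter : Set where
  lo hi none : Letter

_≟ᴸ_ : (x y : Letter) → Dec (x ≡ y)
lo ≟ᴸ lo = yes refl
lo ≟ᴸ hi = no λ ()
lo ≟ᴸ none = no λ ()
hi ≟ᴸ lo = no λ ()
hi ≟ᴸ hi = yes refl
hi ≟ᴸ none = no λ ()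
none ≟ᴸ lo = no λ ()
none ≟ᴸ hi = no λ ()
none ≟ᴸ none = yes refl

isLo : Letter → Bool
isLo lo   = true
isLo hi   = false
isLo none = false

-- Linked points i and i + 1 are those for which the upper square of i is the
-- lower square of i + 1; the condition selects one word for each set of shaded
-- squares.
Canonical : (Fin n → Bool) → Vec Letter (suc n) → Set
Canonical linked w = ∀ i → linked i ≡ true → lookup w (suc i) ≡ lo → lookup w (inject₁ i) ≡ lo

-- The number of canonical words that begin with `x`. The summand for a next letter `lo` drops out
-- when a link follows a letter other than `lo`.
following : Letter → (Fin n → Bool) → ℕ
following {zero}  x linked = 1
following {suc n} x linked =
  (if not (isLo x) ∧ linked zero then 0 else following lo (linked ∘ suc)) +
  (following none (linked ∘ suc) + following hi (linked ∘ suc))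

wordCount : (Fin n → Bool) → ℕ
wordCount linked = following lo linked + (following none linked + following hi linked)


canonical-∷ : ∀ (linked : Fin (suc n) → Bool) x y w →
  Canonical linked (x ∷ y ∷ w) ⇔
  ((linked zero ≡ true → y ≡ lo → x ≡ lo) × Canonical (linked ∘ suc) (y ∷ w))
canonical-∷ linked x y w = mk⇔
  (λ c → c zero , c ∘ suc)
  λ { (c₀ , c) zero → c₀ ; (c₀ , c) (suc i) → c i }

hasCount-∷ : {P : Vec Letter (suc n) → Set} {l o h : ℕ} →
  HasCount (λ w → P (lo ∷ w)) l → HasCount (λ w → P (none ∷ w)) o →
  HasCount (λ w → P (hi ∷ w)) h → HasCount P (l + (o + h))
hasCount-∷ {P = P} Hl Ho Hh = hasCount-cong
  (λ w → mk⇔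
    (λ { (inj₁ (w , Pw , refl)) → Pw
       ; (inj₂ (inj₁ (w , Pw , refl))) → Pw
       ; (inj₂ (inj₂ (w , Pw , refl))) → Pw })
    (split w))
  (hasCount-⊎ (λ { w (_ , _ , refl) (inj₁ (_ , _ , ())) ; w (_ , _ , refl) (inj₂ (_ , _ , ())) })
    (hasCount-image (lo ∷_) Vecₚ.∷-injectiveʳ Hl)
    (hasCount-⊎ (λ { w (_ , _ , refl) (_ , _ , ()) })
      (hasCount-image (none ∷_) Vecₚ.∷-injectiveʳ Ho)
      (hasCount-image (hi ∷_) Vecₚ.∷-injectiveʳ Hh)))
  where
  split : ∀ w → P w → _
  split (lo ∷ w)   Pw = inj₁ (w , Pw , refl)
  split (none ∷ w) Pw = inj₂ (inj₁ (w , Pw , refl))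
  split (hi ∷ w)   Pw = inj₂ (inj₂ (w , Pw , refl))

hasCount-following : ∀ x (linked : Fin n → Bool) →
  HasCount (λ w → Canonical linked (x ∷ w)) (following x linked)
hasCount-following {zero} x linked =
  ([] ∷ []) , [] ∷ [] , (λ { [] → mk⇔ (λ _ ()) λ _ → here refl }) , refl
hasCount-following {suc n} x linked =
  hasCount-∷
    (first-lo (isLo x) refl)
    (hasCount-cong (λ w → mk⇔ (λ c → from (canonical-∷ linked x none w) ((λ _ ()) , c))
                              (proj₂ ∘ to (canonical-∷ linked x none w)))
      (hasCount-following none (linked ∘ suc)))
    (hasCount-cong (λ w → mk⇔ (λ c → from (canonical-∷ linked x hi w) ((λ _ ()) , c))
                              (proj₂ ∘ to (canonical-∷ linked x hi w)))
      (hasCount-following hi (linked ∘ suc)))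
  where
  allowed : (linked zero ≡ true → x ≡ lo) →
    HasCount (λ w → Canonical linked (x ∷ lo ∷ w)) (following lo (linked ∘ suc))
  allowed x-lo = hasCount-cong (λ w → mk⇔
      (λ c → from (canonical-∷ linked x lo w) ((λ l _ → x-lo l) , c))
      (proj₂ ∘ to (canonical-∷ linked x lo w)))
    (hasCount-following lo (linked ∘ suc))
  isLo⇒≡ : ∀ y → isLo y ≡ true → y ≡ lo
  isLo⇒≡ lo _ = refl
  -- Abstracting `isLo x` lets the conditional reduce with two cases instead of three letters.
  first-lo : ∀ b → isLo x ≡ b → HasCount (λ w → Canonical linked (x ∷ lo ∷ w))
    (if not b ∧ linked zero then 0 else following lo (linked ∘ suc))
  first-lo true  x-lo = allowed λ _ → isLo⇒≡ x x-lo
  first-lo false x-other with linked zero in linked₀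
  ... | false = allowed λ l → case trans (sym l) linked₀ of λ ()
  ... | true  = hasCount-none λ w c → case trans (sym (cong isLo (c zero linked₀ refl))) x-other of λ ()

hasCount-canonical : (linked : Fin n → Bool) → HasCount (Canonical linked) (wordCount linked)
hasCount-canonical linked = hasCount-∷ (hasCount-following lo linked)
  (hasCount-following none linked) (hasCount-following hi linked)

-- Bounds on the number of canonical words

open +-*-Solver using (solve; _:+_; _:*_; _:=_; con)

-- What may follow depends only on whether the first letter is `lo`. The counts thus reduce to two
-- sequences, for `lo` and for `none`.
hi-like-none : (linked : Fin n → Bool) → following hi linked ≡ following none linked
hi-like-none {zero}  linked = refl
hi-like-none {suc n} linked = refl

following-none : (linked : Fin (suc n) → Bool) → following none linked ≡
  (if linked zero then 0 else following lo (linked ∘ suc)) + 2 * following none (linked ∘ suc)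
following-none linked = cong (λ h → (if linked zero then 0 else following lo (linked ∘ suc)) + (following none (linked ∘ suc) + h))
  (trans (hi-like-none (linked ∘ suc)) (sym (ℕ.+-identityʳ _)))

wordCount-split : (linked : Fin n → Bool) → wordCount linked ≡ following lo linked + 2 * following none linked
wordCount-split linked = cong (λ h → following lo linked + (following none linked + h))
  (trans (hi-like-none linked) (sym (ℕ.+-identityʳ _)))

true-or-false : ∀ b → b ≡ true ⊎ b ≡ false
true-or-false true  = inj₁ refl
true-or-false false = inj₂ refl

module _ (linked : Fin (suc n) → Bool) (¬linked₀ : linked zero ≡ false) where

  following-none-unlinked : following none linked ≡ wordCount (linked ∘ suc)
  following-none-unlinked rewrite ¬linked₀ = refl

  wordCount-unlinked : wordCount linked ≡ 3 * wordCount (linked ∘ suc)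
  wordCount-unlinked = trans (wordCount-split linked)
    (cong (λ y → wordCount (linked ∘ suc) + 2 * y) following-none-unlinked)

module _ (linked : Fin (suc n) → Bool) (linked₀ : linked zero ≡ true) where

  following-none-linked : following none linked ≡ 2 * following none (linked ∘ suc)
  following-none-linked = trans (following-none linked)
    (cong (λ b → (if b then 0 else following lo (linked ∘ suc)) + 2 * following none (linked ∘ suc)) linked₀)

  -- After `lo` every canonical tail is allowed. After `none` or `hi` the tail must itself begin
  -- with `none` or `hi`, which gives 2 · 2 equal summands.
  wordCount-linked : wordCount linked ≡ wordCount (linked ∘ suc) + 4 * following none (linked ∘ suc)
  wordCount-linked = trans (wordCount-split linked) (trans
    (cong (λ y → wordCount (linked ∘ suc) + 2 * y) following-none-linked)
    (cong (wordCount (linked ∘ suc) +_) (sym (ℕ.*-assoc 2 2 (following none (linked ∘ suc))))))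

-- 2^(n+2) − 1, the number of canonical words on a run of n + 1 points.
runCount : ℕ → ℕ
runCount zero    = 3
runCount (suc n) = 1 + 2 * runCount n

3≤runCount : ∀ n → 3 ≤ runCount n
3≤runCount zero    = ℕ.≤-refl
3≤runCount (suc n) = ℕ.≤-trans (3≤runCount n) (ℕ.≤-trans (ℕ.m≤m+n _ _) (ℕ.n≤1+n _))

-- 3^(n+1), the number of all words of length n + 1.
freeCount : ℕ → ℕ
freeCount zero    = 3
freeCount (suc n) = 3 * freeCount n

0<freeCount : ∀ n → 0 < freeCount n
0<freeCount zero    = s≤s z≤n
0<freeCount (suc n) = ℕ.≤-trans (0<freeCount n) (ℕ.m≤m+n _ _)

-- The value for a monotone permutation of size n + 1: everything is linked in one direction and
-- nothing in the other.
leastCount : ℕ → ℕ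
leastCount n = runCount n * freeCount n

wordCount-all-unlinked : (linked : Fin n → Bool) → (∀ i → linked i ≡ false) → wordCount linked ≡ freeCount n
wordCount-all-unlinked {zero}  linked none-linked = refl
wordCount-all-unlinked {suc n} linked none-linked = trans (wordCount-unlinked linked (none-linked zero))
  (cong (3 *_) (wordCount-all-unlinked (linked ∘ suc) (none-linked ∘ suc)))

-- The two equations are proved together because the recursion for `wordCount` needs
-- `following none`, which is 2^n here.
all-linked-counts : (linked : Fin n → Bool) → (∀ i → linked i ≡ true) →
  wordCount linked ≡ runCount n × 4 * following none linked ≡ 1 + runCount n
all-linked-counts {zero}  linked all-linked = refl , refl
all-linked-counts {suc n} linked all-linked =
  let w , f = all-linked-counts (linked ∘ suc) (all-linked ∘ suc) in
  trans (wordCount-linked linked (all-linked zero)) (trans (cong₂ _+_ w f)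
    (solve 1 (λ c → c :+ (con 1 :+ c) := con 1 :+ con 2 :* c) refl (runCount n))) ,
  trans (cong (4 *_) (following-none-linked linked (all-linked zero)))
   (trans (solve 1 (λ y → con 4 :* (con 2 :* y) := con 2 :* (con 4 :* y)) refl (following none (linked ∘ suc)))
   (trans (cong (2 *_) f)
    (solve 1 (λ c → con 2 :* (con 1 :+ c) := con 1 :+ (con 1 :+ con 2 :* c)) refl (runCount n))))

-- Sharp when everything is linked.
wordCount≤following : (linked : Fin n → Bool) →
  wordCount linked * (1 + runCount n) ≤ 4 * following none linked * runCount n
wordCount≤following {zero}  linked = ℕ.≤-refl
wordCount≤following {suc n} linked with true-or-false (linked zero)
-- Without a link `following none linked` equals `t`, and the claim comes down to 3 ≤ `c′`.
... | inj₂ eq rewrite wordCount-unlinked linked eq | following-none-unlinked linked eq = begin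
    3 * t * (1 + c′)       ≡⟨ solve 2 (λ t c′ → con 3 :* t :* (con 1 :+ c′) := con 3 :* t :* c′ :+ t :* con 3) refl t c′ ⟩
    3 * t * c′ + t * 3     ≤⟨ ℕ.+-monoʳ-≤ (3 * t * c′) (ℕ.*-monoʳ-≤ t (3≤runCount (suc n))) ⟩
    3 * t * c′ + t * c′    ≡⟨ solve 2 (λ t c′ → con 3 :* t :* c′ :+ t :* c′ := con 4 :* t :* c′) refl t c′ ⟩
    4 * t * c′ ∎
  where
  open ℕ.≤-Reasoning
  t = wordCount (linked ∘ suc)
  c′ = runCount (suc n)
... | inj₁ eq rewrite wordCount-linked linked eq | following-none-linked linked eq = begin
    (t + 4 * y) * (1 + (1 + 2 * c))
      ≡⟨ solve 3 (λ t y c → (t :+ con 4 :* y) :* (con 1 :+ (con 1 :+ con 2 :* c))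
                         := con 2 :* (t :* (con 1 :+ c)) :+ con 8 :* y :* (con 1 :+ c)) refl t y c ⟩
    2 * (t * (1 + c)) + 8 * y * (1 + c)
      ≤⟨ ℕ.+-monoˡ-≤ (8 * y * (1 + c)) (ℕ.*-monoʳ-≤ 2 (wordCount≤following (linked ∘ suc))) ⟩
    2 * (4 * y * c) + 8 * y * (1 + c)
      ≡⟨ solve 2 (λ y c → con 2 :* (con 4 :* y :* c) :+ con 8 :* y :* (con 1 :+ c)
                       := con 4 :* (con 2 :* y) :* (con 1 :+ con 2 :* c)) refl y c ⟩
    4 * (2 * y) * (1 + 2 * c) ∎
  where
  open ℕ.≤-Reasoning
  t = wordCount (linked ∘ suc)
  y = following none (linked ∘ suc)
  c = runCount n

-- In terms of ratios: a link in front multiplies the number of words by at least `runCount (suc n)`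
-- / `runCount n`, the factor met when everything is linked.
wordCount-linked-bound : (linked : Fin (suc n) → Bool) → linked zero ≡ true →
  wordCount (linked ∘ suc) * runCount (suc n) ≤ wordCount linked * runCount n
wordCount-linked-bound {n} linked linked₀ rewrite wordCount-linked linked linked₀ = begin
  t * (1 + 2 * c)         ≡⟨ solve 2 (λ t c → t :* (con 1 :+ con 2 :* c) := t :* c :+ t :* (con 1 :+ c)) refl t c ⟩
  t * c + t * (1 + c)     ≤⟨ ℕ.+-monoʳ-≤ (t * c) (wordCount≤following (linked ∘ suc)) ⟩
  t * c + 4 * y * c       ≡⟨ ℕ.*-distribʳ-+ c t (4 * y) ⟨
  (t + 4 * y) * c         ∎
  where
  open ℕ.≤-Reasoning
  t = wordCount (linked ∘ suc)
  y = following none (linked ∘ suc)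
  c = runCount n

runCount-nonZero : ∀ n → NonZero (runCount n)
runCount-nonZero n = >-nonZero (ℕ.≤-trans (s≤s z≤n) (3≤runCount n))

private
  module LinkedStep (b c : Fin (suc n) → Bool) (b₀ : b zero ≡ true) (c₀ : c zero ≡ false) where
    r r′ p t t′ u : ℕ
    r = runCount n
    r′ = runCount (suc n)
    p = freeCount n
    t = wordCount (b ∘ suc)
    t′ = wordCount b
    u = wordCount (c ∘ suc)

    rearrange : r * (r′ * (3 * p)) ≡ 3 * r′ * (r * p)
    rearrange = solve 3 (λ r r′ p → r :* (r′ :* (con 3 :* p)) := con 3 :* r′ :* (r :* p)) refl r r′ p

    -- `wordCount c` is `3 * u`, and `wordCount b` exceeds `t` by at least the factor `r′` / `r`.
    -- The product of these two factors is exactly the growth of `leastCount`. Multiplying through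
    -- by `r` avoids division.
    product-bound : 3 * r′ * (t * u) ≤ r * (t′ * wordCount c)
    product-bound = begin
      3 * r′ * (t * u)       ≡⟨ solve 3 (λ r′ t u → con 3 :* r′ :* (t :* u) := con 3 :* u :* (t :* r′)) refl r′ t u ⟩
      3 * u * (t * r′)       ≤⟨ ℕ.*-monoʳ-≤ (3 * u) (wordCount-linked-bound b b₀) ⟩
      3 * u * (t′ * r)       ≡⟨ solve 3 (λ r t′ u → con 3 :* u :* (t′ :* r) := r :* (t′ :* (con 3 :* u))) refl r t′ u ⟩
      r * (t′ * (3 * u))     ≡⟨ cong (λ w → r * (t′ * w)) (wordCount-unlinked c c₀) ⟨
      r * (t′ * wordCount c) ∎
      where open ℕ.≤-Reasoning

  linked-step-≤ : (b c : Fin (suc n) → Bool) → b zero ≡ true → c zero ≡ false →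
    leastCount n ≤ wordCount (b ∘ suc) * wordCount (c ∘ suc) →
    leastCount (suc n) ≤ wordCount b * wordCount c
  linked-step-≤ {n} b c b₀ c₀ ih = ℕ.*-cancelˡ-≤ r ⦃ runCount-nonZero n ⦄
    (ℕ.≤-trans (ℕ.≤-reflexive rearrange) (ℕ.≤-trans (ℕ.*-monoʳ-≤ (3 * r′) ih) product-bound))
    where open LinkedStep b c b₀ c₀

  linked-step-< : (b c : Fin (suc n) → Bool) → b zero ≡ true → c zero ≡ false →
    leastCount n < wordCount (b ∘ suc) * wordCount (c ∘ suc) →
    leastCount (suc n) < wordCount b * wordCount c
  linked-step-< {n} b c b₀ c₀ ih = ℕ.*-cancelˡ-< r _ _
    (ℕ.≤-<-trans (ℕ.≤-reflexive rearrange) (ℕ.<-≤-trans (ℕ.*-monoʳ-< (3 * r′) ih) product-bound))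
    where open LinkedStep b c b₀ c₀

  -- The product grows by the factor 9, but `leastCount` only by 6 + 3/r with r = `runCount n` ≥ 3.
  -- The inequality is therefore strict even if the one for the tails is not.
  unlinked-step : (b c : Fin (suc n) → Bool) → b zero ≡ false → c zero ≡ false →
    leastCount n ≤ wordCount (b ∘ suc) * wordCount (c ∘ suc) →
    leastCount (suc n) < wordCount b * wordCount c
  unlinked-step {n} b c b₀ c₀ ih = begin-strict
    (1 + 2 * r) * (3 * p)          ≡⟨ solve 2 (λ r p → (con 1 :+ con 2 :* r) :* (con 3 :* p) := con 6 :* (r :* p) :+ con 3 :* p) refl r p ⟩
    6 * (r * p) + 3 * p            <⟨ ℕ.+-monoʳ-< (6 * (r * p)) (ℕ.*-monoˡ-< p ⦃ >-nonZero (0<freeCount n) ⦄ {3} {9} (s≤s (s≤s (s≤s (s≤s z≤n))))) ⟩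
    6 * (r * p) + 9 * p            ≤⟨ ℕ.+-monoʳ-≤ (6 * (r * p)) (ℕ.*-monoˡ-≤ p (ℕ.*-monoʳ-≤ 3 (3≤runCount n))) ⟩
    6 * (r * p) + 3 * r * p        ≡⟨ solve 2 (λ r p → con 6 :* (r :* p) :+ con 3 :* r :* p := con 9 :* (r :* p)) refl r p ⟩
    9 * (r * p)                    ≤⟨ ℕ.*-monoʳ-≤ 9 ih ⟩
    9 * (t * u)                    ≡⟨ solve 2 (λ t u → con 9 :* (t :* u) := con 3 :* t :* (con 3 :* u)) refl t u ⟩
    3 * t * (3 * u)                ≡⟨ cong₂ _*_ (wordCount-unlinked b b₀) (wordCount-unlinked c c₀) ⟨
    wordCount b * wordCount c      ∎
    where
    open ℕ.≤-Reasoning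
    r = runCount n
    p = freeCount n
    t = wordCount (b ∘ suc)
    u = wordCount (c ∘ suc)

Exclusive : (Fin n → Bool) → (Fin n → Bool) → Set
Exclusive b c = ∀ i → b i ≡ true → c i ≡ true → ⊥

leastCount≤ : (b c : Fin n → Bool) → Exclusive b c → leastCount n ≤ wordCount b * wordCount c
leastCount≤ {zero}  b c excl = ℕ.≤-refl
leastCount≤ {suc n} b c excl
  with true-or-false (b zero) | true-or-false (c zero) | leastCount≤ (b ∘ suc) (c ∘ suc) (excl ∘ suc)
... | inj₁ b₀ | inj₁ c₀ | _  = ⊥-elim (excl zero b₀ c₀)
... | inj₁ b₀ | inj₂ c₀ | ih = linked-step-≤ b c b₀ c₀ ih
... | inj₂ b₀ | inj₁ c₀ | ih = subst (leastCount (suc n) ≤_) (ℕ.*-comm (wordCount c) (wordCount b))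
  (linked-step-≤ c b c₀ b₀ (subst (leastCount n ≤_) (ℕ.*-comm (wordCount (b ∘ suc)) (wordCount (c ∘ suc))) ih))
... | inj₂ b₀ | inj₂ c₀ | ih = ℕ.<⇒≤ (unlinked-step b c b₀ c₀ ih)

-- Strictness arises at the position `i` linked in neither direction, and linked steps in front of
-- it preserve it.
leastCount< : (b c : Fin n → Bool) → Exclusive b c →
  ∀ i → b i ≡ false → c i ≡ false → leastCount n < wordCount b * wordCount c
leastCount< b c excl zero bᵢ cᵢ =
  unlinked-step b c bᵢ cᵢ (leastCount≤ (b ∘ suc) (c ∘ suc) (excl ∘ suc))
leastCount< {suc n} b c excl (suc i) bᵢ cᵢ
  with true-or-false (b zero) | true-or-false (c zero) | leastCount< (b ∘ suc) (c ∘ suc) (excl ∘ suc) i bᵢ cᵢ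
... | inj₁ b₀ | inj₁ c₀ | _  = ⊥-elim (excl zero b₀ c₀)
... | inj₁ b₀ | inj₂ c₀ | ih = linked-step-< b c b₀ c₀ ih
... | inj₂ b₀ | inj₁ c₀ | ih = subst (leastCount (suc n) <_) (ℕ.*-comm (wordCount c) (wordCount b))
  (linked-step-< c b c₀ b₀ (subst (leastCount n <_) (ℕ.*-comm (wordCount (b ∘ suc)) (wordCount (c ∘ suc))) ih))
... | inj₂ b₀ | inj₂ c₀ | ih = unlinked-step b c b₀ c₀ (ℕ.<⇒≤ ih)

0<following : ∀ x (linked : Fin n → Bool) → 0 < following x linked
0<following {zero}  x linked = s≤s z≤n
0<following {suc n} x linked = ℕ.<-≤-trans (0<following none (linked ∘ suc)) (ℕ.≤-trans
  (ℕ.m≤m+n _ (following hi (linked ∘ suc)))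
  (ℕ.m≤n+m _ (if not (isLo x) ∧ linked zero then 0 else following lo (linked ∘ suc))))

-- With t = x + 2 y words on the remaining letters, a link leaves t + 4 y < 3 t words.
wordCount-linked-< : (linked : Fin (suc n) → Bool) → linked zero ≡ true →
  wordCount linked < 3 * wordCount (linked ∘ suc)
wordCount-linked-< linked linked₀
  rewrite wordCount-linked linked linked₀ | wordCount-split (linked ∘ suc) = begin-strict
    x + 2 * y + 4 * y            <⟨ ℕ.+-monoˡ-< (4 * y) (ℕ.+-monoˡ-< (2 * y) (ℕ.m<m+n x (ℕ.<-≤-trans (0<following lo (linked ∘ suc)) (ℕ.m≤m+n x _)))) ⟩
    3 * x + 2 * y + 4 * y        ≡⟨ solve 2 (λ x y → con 3 :* x :+ con 2 :* y :+ con 4 :* y := con 3 :* (x :+ con 2 :* y)) refl x y ⟩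
    3 * (x + 2 * y)              ∎
  where
  open ℕ.≤-Reasoning
  x = following lo (linked ∘ suc)
  y = following none (linked ∘ suc)

wordCount≤freeCount : (linked : Fin n → Bool) → wordCount linked ≤ freeCount n
wordCount≤freeCount {zero}  linked = ℕ.≤-refl
wordCount≤freeCount {suc n} linked with true-or-false (linked zero)
... | inj₂ eq rewrite wordCount-unlinked linked eq = ℕ.*-monoʳ-≤ 3 (wordCount≤freeCount (linked ∘ suc))
... | inj₁ eq = ℕ.≤-trans (ℕ.<⇒≤ (wordCount-linked-< linked eq)) (ℕ.*-monoʳ-≤ 3 (wordCount≤freeCount (linked ∘ suc)))

wordCount<freeCount : (linked : Fin n → Bool) → ∀ i → linked i ≡ true → wordCount linked < freeCount n
wordCount<freeCount linked zero eq =
  ℕ.<-≤-trans (wordCount-linked-< linked eq) (ℕ.*-monoʳ-≤ 3 (wordCount≤freeCount (linked ∘ suc)))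
wordCount<freeCount {suc n} linked (suc i) eq with true-or-false (linked zero)
... | inj₂ eq₀ rewrite wordCount-unlinked linked eq₀ = ℕ.*-monoʳ-< 3 (wordCount<freeCount (linked ∘ suc) i eq)
... | inj₁ eq₀ = ℕ.<-≤-trans (wordCount-linked-< linked eq₀) (ℕ.*-monoʳ-≤ 3 (wordCount≤freeCount (linked ∘ suc)))

-- Increasing maps between finite ordinals

Increasing : (Fin m → Fin n) → Set
Increasing u = ∀ {a b} → a Fin.< b → u a Fin.< u b

increasing-lower : (u : Fin m → Fin n) → Increasing u → ∀ i → toℕ i ≤ toℕ (u i)
increasing-lower u u-inc = go u u-inc 0 λ _ → z≤n
  where
  -- The offset `d` bounds all values from below and rises by one with each position removed.
  go : (u : Fin m → Fin n) → Increasing u → ∀ d → (∀ i → d ≤ toℕ (u i)) → ∀ i → d + toℕ i ≤ toℕ (u i)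
  go u u-inc d d≤ zero    = subst (_≤ toℕ (u zero)) (sym (ℕ.+-identityʳ d)) (d≤ zero)
  go u u-inc d d≤ (suc i) = subst (_≤ toℕ (u (suc i))) (sym (ℕ.+-suc d (toℕ i)))
    (go (u ∘ suc) (λ a<b → u-inc (s≤s a<b)) (suc d)
      (λ j → ℕ.≤-<-trans (d≤ zero) (u-inc {zero} {suc j} (s≤s z≤n))) i)

-- Above `u i` there must be room for the images of all positions above `i`; the inequality is
-- written without subtraction.
increasing-upper : (u : Fin m → Fin n) → Increasing u → ∀ i → m + toℕ (u i) ≤ n + toℕ i
increasing-upper {suc zero}    {n} u u-inc zero = subst (suc (toℕ (u zero)) ≤_) (sym (ℕ.+-identityʳ n)) (Finₚ.toℕ<n (u zero))
increasing-upper {suc (suc m)} {n} u u-inc zero = begin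
  suc (suc m) + toℕ (u zero)         ≡⟨ ℕ.+-suc (suc m) _ ⟨
  suc m + suc (toℕ (u zero))         ≤⟨ ℕ.+-monoʳ-≤ (suc m) (u-inc {zero} {suc zero} (s≤s z≤n)) ⟩
  suc m + toℕ (u (suc zero))         ≤⟨ increasing-upper (u ∘ suc) (λ a<b → u-inc (s≤s a<b)) zero ⟩
  n + 0                              ∎
  where open ℕ.≤-Reasoning
increasing-upper {suc m} {n} u u-inc (suc i) = subst (suc m + toℕ (u (suc i)) ≤_) (sym (ℕ.+-suc n (toℕ i)))
  (s≤s (increasing-upper (u ∘ suc) (λ a<b → u-inc (s≤s a<b)) i))

increasing-id : (u : Fin n → Fin n) → Increasing u → ∀ i → u i ≡ i
increasing-id {n} u u-inc i = Finₚ.toℕ-injective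
  (ℕ.≤-antisym (ℕ.+-cancelˡ-≤ n _ _ (increasing-upper u u-inc i)) (increasing-lower u u-inc i))

increasing-injective : {u : Fin m → Fin n} → Increasing u → ∀ {a b} → u a ≡ u b → a ≡ b
increasing-injective {u = u} u-inc {a} {b} ua≡ub with Finₚ.<-cmp a b
... | tri< a<b _ _ = contradiction ua≡ub (Finₚ.<⇒≢ (u-inc a<b))
... | tri≈ _ a≡b _ = a≡b
... | tri> _ _ b<a = contradiction (sym ua≡ub) (Finₚ.<⇒≢ (u-inc b<a))

missed : (u : Fin n → Fin (suc n)) → ∃[ q ] (∀ i → q ≢ u i)
missed {n} u with Finₚ.any? (λ q → Finₚ.all? λ i → ¬? (q Finₚ.≟ u i))
... | yes q = q
... | no ¬q = ⊥-elim (collision (Finₚ.pigeonhole ℕ.≤-refl (proj₁ ∘ preimage)))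
  where
  preimage : ∀ q → ∃[ i ] q ≡ u i
  preimage q with Finₚ.any? (λ i → q Finₚ.≟ u i)
  ... | yes i = i
  ... | no ¬i = contradiction (q , λ i q≡ → ¬i (i , q≡)) ¬q
  collision : ¬ (∃[ i ] ∃[ j ] (i Fin.< j × proj₁ (preimage i) ≡ proj₁ (preimage j)))
  collision (i , j , i<j , eq) = Finₚ.<⇒≢ i<j
    (trans (proj₂ (preimage i)) (trans (cong u eq) (sym (proj₂ (preimage j)))))

-- Closing the gap at the missed value turns `u` into an increasing self-map of `Fin n`, which is
-- the identity. Hence an occurrence of a pattern in a permutation with one more point is the
-- deletion of a point.
increasing-punchIn : (u : Fin n → Fin (suc n)) → Increasing u → ∃[ q ] (∀ i → u i ≡ punchIn q i)
increasing-punchIn u u-inc with q , q∉ ← missed u = q , λ i →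
  trans (sym (Finₚ.punchIn-punchOut (q∉ i))) (cong (punchIn q) (increasing-id (λ i → punchOut (q∉ i)) v-inc i))
  where
  v-inc : Increasing (λ i → punchOut (q∉ i))
  v-inc {a} {b} a<b = ℕ.≤∧≢⇒< (Finₚ.punchOut-mono-≤ (q∉ a) (q∉ b) (ℕ.<⇒≤ (u-inc a<b)))
    λ eq → Finₚ.<⇒≢ a<b (increasing-injective u-inc (Finₚ.punchOut-injective (q∉ a) (q∉ b) (Finₚ.toℕ-injective eq)))

punchIn-< : ∀ (v : Fin (suc n)) j → toℕ j < toℕ v → punchIn v j ≡ inject₁ j
punchIn-< (suc v) zero    _         = refl
punchIn-< (suc v) (suc j) (s≤s j<v) = cong suc (punchIn-< v j j<v)

punchIn-≥ : ∀ (v : Fin (suc n)) j → toℕ v ≤ toℕ j → punchIn v j ≡ suc j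
punchIn-≥ zero    j       _         = refl
punchIn-≥ (suc v) (suc j) (s≤s v≤j) = cong suc (punchIn-≥ v j v≤j)

suc-mono⇒increasing : (u : Fin (suc n) → Fin m) → (∀ i → u (inject₁ i) Fin.< u (suc i)) → Increasing u
suc-mono⇒increasing u step {a} {b} = <-weakInduction (λ b → ∀ a → a Fin.< b → u a Fin.< u b)
  (λ _ ()) advance b a
  where
  advance : ∀ i → (∀ a → a Fin.< inject₁ i → u a Fin.< u (inject₁ i)) → ∀ a → a Fin.< suc i → u a Fin.< u (suc i)
  advance i ih a (s≤s a≤i) with Finₚ.<-cmp a (inject₁ i)
  ... | tri< a<i _ _  = ℕ.<-trans (ih a a<i) (step i)
  ... | tri≈ _ refl _ = step i
  ... | tri> _ _ i<a  = contradiction (subst (_< toℕ a) (Finₚ.toℕ-inject₁ i) i<a) (ℕ.≤⇒≯ a≤i)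

-- Consecutive positions

⟨$⟩ʳ-injective : (π : Permutation′ n) → ∀ {i j} → π ⟨$⟩ʳ i ≡ π ⟨$⟩ʳ j → i ≡ j
⟨$⟩ʳ-injective π {i} {j} eq = trans (sym (inverseˡ π)) (trans (cong (π ⟨$⟩ˡ_) eq) (inverseˡ π))

consecutive : {P : Fin (suc n) → Fin (suc n) → Set} → (∀ i → P (inject₁ i) (suc i)) →
  ∀ i j → toℕ j ≡ suc (toℕ i) → P i j
consecutive {P = P} P-suc i (suc j) eq = subst (λ i → P i (suc j))
  (Finₚ.toℕ-injective (trans (Finₚ.toℕ-inject₁ j) (ℕ.suc-injective eq))) (P-suc j)

∣-∣≡1⇒ : ∀ x y → ∣ x - y ∣ ≡ 1 → suc x ≡ y ⊎ x ≡ suc y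
∣-∣≡1⇒ zero    y       eq = inj₁ (sym eq)
∣-∣≡1⇒ (suc x) zero    eq = inj₂ eq
∣-∣≡1⇒ (suc x) (suc y) eq = Sum.map (cong suc) (cong suc) (∣-∣≡1⇒ x y eq)

∣n-1+n∣≡1 : ∀ n → ∣ n - suc n ∣ ≡ 1
∣n-1+n∣≡1 zero    = refl
∣n-1+n∣≡1 (suc n) = ∣n-1+n∣≡1 n

module _ (π : Permutation′ (suc n)) where

  -- The equations are between rows of squares, so that they say literally that the right square of
  -- one point is the left square of the next in the given direction.
  Ascent Descent : Fin n → Set
  Ascent  i = suc (π ⟨$⟩ʳ inject₁ i) ≡ inject₁ (π ⟨$⟩ʳ suc i)
  Descent i = inject₁ (π ⟨$⟩ʳ inject₁ i) ≡ suc (π ⟨$⟩ʳ suc i)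

  step≡1⇔ : ∀ i → step π (inject₁ i) (suc i) ≡ 1 ⇔ (Ascent i ⊎ Descent i)
  step≡1⇔ i = mk⇔
    (Sum.map
      (λ eq → Finₚ.toℕ-injective (trans eq (sym (Finₚ.toℕ-inject₁ y))))
      (λ eq → Finₚ.toℕ-injective (trans (Finₚ.toℕ-inject₁ x) eq))
      ∘ ∣-∣≡1⇒ (toℕ x) (toℕ y))
    [ (λ asc → trans (cong (∣ toℕ x -_∣) (trans (sym (Finₚ.toℕ-inject₁ y)) (sym (cong toℕ asc)))) (∣n-1+n∣≡1 (toℕ x)))
    , (λ desc → trans (cong (∣_- toℕ y ∣) (trans (sym (Finₚ.toℕ-inject₁ x)) (cong toℕ desc)))
                      (trans (ℕ.∣-∣-comm (suc (toℕ y)) (toℕ y)) (∣n-1+n∣≡1 (toℕ y)))) ]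
    where
    x y : Fin (suc n)
    x = π ⟨$⟩ʳ inject₁ i
    y = π ⟨$⟩ʳ suc i

  AllStepsOne⇔ : AllStepsOne π ⇔ (∀ i → Ascent i ⊎ Descent i)
  AllStepsOne⇔ = mk⇔
    (λ all i → to (step≡1⇔ i) (all (inject₁ i) (suc i) (cong suc (sym (Finₚ.toℕ-inject₁ i)))))
    (λ all → consecutive (λ i → from (step≡1⇔ i) (all i)))

  NoStepOne⇔ : NoStepOne π ⇔ (∀ i → ¬ Ascent i × ¬ Descent i)
  NoStepOne⇔ = mk⇔
    (λ noOne i → let not-one = noOne (inject₁ i) (suc i) (cong suc (sym (Finₚ.toℕ-inject₁ i))) ∘ from (step≡1⇔ i) in
      not-one ∘ inj₁ , not-one ∘ inj₂)
    (λ noOne → consecutive (λ i one → [ proj₁ (noOne i) , proj₂ (noOne i) ] (to (step≡1⇔ i) one)))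

  ascents⇒id : (∀ i → Ascent i) → π ≈ id
  ascents⇒id asc = increasing-id (π ⟨$⟩ʳ_) (suc-mono⇒increasing (π ⟨$⟩ʳ_) λ i →
    ℕ.≤-reflexive (trans (cong toℕ (asc i)) (Finₚ.toℕ-inject₁ _)))

opposite-antitone : {i j : Fin n} → i Fin.< j → opposite j Fin.< opposite i
opposite-antitone {n} {i} {j} i<j = subst₂ _<_ (sym (Finₚ.opposite-prop j)) (sym (Finₚ.opposite-prop i))
  (ℕ.∸-monoʳ-< (s≤s i<j) (Finₚ.toℕ<n j))

module _ (π : Permutation′ (suc n)) where

  descents⇒reverse : (∀ i → Descent π i) → π ≈ reverse
  descents⇒reverse desc i = trans (sym (Finₚ.opposite-involutive (π ⟨$⟩ʳ i)))
    (cong opposite (increasing-id (λ i → opposite (π ⟨$⟩ʳ i)) (suc-mono⇒increasing _ λ i →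
      opposite-antitone (ℕ.≤-reflexive (trans (sym (cong toℕ (desc i))) (Finₚ.toℕ-inject₁ _)))) i))

-- A change of direction would make π take the same value at two positions at distance two.
ascents-or-descents : (π : Permutation′ (suc n)) → (∀ i → Ascent π i ⊎ Descent π i) →
  (∀ i → Ascent π i) ⊎ (∀ i → Descent π i)
ascents-or-descents {zero}  π steps = inj₁ λ ()
ascents-or-descents {suc n} π steps = Sum.map
  (λ asc₀ → <-weakInduction (Ascent π) asc₀ λ i asc → [ (λ asc′ → asc′) , (λ desc → ⊥-elim (turn-back i asc desc)) ] (steps (suc i)))
  (λ desc₀ → <-weakInduction (Descent π) desc₀ λ i desc → [ (λ asc → ⊥-elim (turn-back′ i desc asc)) , (λ desc′ → desc′) ] (steps (suc i)))
  (steps zero)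
  where
  return : ∀ i → π ⟨$⟩ʳ inject₁ (inject₁ i) ≢ π ⟨$⟩ʳ suc (suc i)
  return i eq = ℕ.m≢1+m+n (toℕ i) {1} (trans
    (sym (trans (Finₚ.toℕ-inject₁ (inject₁ i)) (Finₚ.toℕ-inject₁ i)))
    (trans (cong toℕ (⟨$⟩ʳ-injective π eq)) (cong suc (ℕ.+-comm 1 (toℕ i)))))
  turn-back : ∀ i → Ascent π (inject₁ i) → ¬ Descent π (suc i)
  turn-back i asc desc = return i (Finₚ.suc-injective (trans asc desc))
  turn-back′ : ∀ i → Descent π (inject₁ i) → ¬ Ascent π (suc i)
  turn-back′ i desc asc = return i (Finₚ.inject₁-injective (trans desc asc))

opposite-inject₁ : ∀ (i : Fin n) → toℕ (opposite (inject₁ i)) ≡ suc (toℕ (opposite i))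
opposite-inject₁ {n} i = trans (Finₚ.opposite-prop (inject₁ i)) (trans
  (cong (n ∸_) (Finₚ.toℕ-inject₁ i))
  (trans (ℕ.+-∸-assoc 1 (Finₚ.toℕ<n i)) (cong suc (sym (Finₚ.opposite-prop i)))))

AllStepsOne⇔id⊎reverse : (π : Permutation′ (suc n)) → AllStepsOne π ⇔ (π ≈ id ⊎ π ≈ reverse)
AllStepsOne⇔id⊎reverse {n} π = mk⇔
  (λ all → Sum.map (ascents⇒id π) (descents⇒reverse π) (ascents-or-descents π (to (AllStepsOne⇔ π) all)))
  λ eq → from (AllStepsOne⇔ π) ([ (λ ≈id i → inj₁ (id-ascent ≈id i)) , (λ ≈rev i → inj₂ (reverse-descent ≈rev i)) ] eq)
  where
  id-ascent : π ≈ id → ∀ i → Ascent π i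
  id-ascent ≈id i = trans (cong suc (≈id (inject₁ i))) (cong inject₁ (sym (≈id (suc i))))
  reverse-descent : π ≈ reverse → ∀ i → Descent π i
  reverse-descent ≈rev i = trans (cong inject₁ (≈rev (inject₁ i))) (trans
    (Finₚ.toℕ-injective (trans (Finₚ.toℕ-inject₁ _) (trans (opposite-inject₁ i) (cong suc (sym (Finₚ.toℕ-inject₁ (opposite i)))))))
    (cong suc (sym (≈rev (suc i)))))

-- Permutations without steps of size one

-- Reversal puts the last entry next to the new maximum. If that entry is not the old maximum, the
-- new step is not one; the new last entry is an old one and so lies below the new maximum, which
-- lets the construction be repeated.
prependMax : Permutation′ n → Permutation′ (suc n)
prependMax {n} π = insert zero (fromℕ n) (reverse ∘ₚ π)

prependMax-suc : (π : Permutation′ n) → ∀ i → toℕ (prependMax π ⟨$⟩ʳ suc i) ≡ toℕ (π ⟨$⟩ʳ opposite i)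
prependMax-suc {n} π i = trans
  (cong toℕ (trans (insert-punchIn zero (fromℕ n) (reverse ∘ₚ π) i)
    (punchIn-< (fromℕ n) _ (subst (toℕ (π ⟨$⟩ʳ opposite i) <_) (sym (Finₚ.toℕ-fromℕ n)) (Finₚ.toℕ<n _)))))
  (Finₚ.toℕ-inject₁ _)

prependMax-noStepOne : (π : Permutation′ (suc n)) → NoStepOne π → toℕ (π ⟨$⟩ʳ fromℕ n) ≢ n → NoStepOne (prependMax π)
prependMax-noStepOne {n} π noOne last = consecutive steps
  where
  steps : ∀ i → step (prependMax π) (inject₁ i) (suc i) ≢ 1
  steps zero one = [ (λ eq → ℕ.<⇒≱ (Finₚ.toℕ<n (π ⟨$⟩ʳ fromℕ n)) (ℕ.≤-trans (ℕ.n≤1+n _) (ℕ.≤-reflexive eq)))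
                   , (λ eq → last (sym (ℕ.suc-injective eq))) ]
    (∣-∣≡1⇒ (suc n) _ (trans (cong₂ ∣_-_∣ (cong suc (sym (Finₚ.toℕ-fromℕ n))) (sym (prependMax-suc π zero))) one))
  steps (suc i) one = noOne (opposite (suc i)) (opposite (inject₁ i))
    (trans (opposite-inject₁ i) (cong suc (sym (Finₚ.toℕ-inject₁ (opposite i)))))
    (trans (ℕ.∣-∣-comm (toℕ (π ⟨$⟩ʳ opposite (suc i))) _)
      (trans (cong₂ ∣_-_∣ (sym (prependMax-suc π (inject₁ i))) (sym (prependMax-suc π (suc i)))) one))

noStepOne-exists : ∀ n → ∃[ τ ] NoStepOne {4 + n} τ × toℕ (τ ⟨$⟩ʳ fromℕ (3 + n)) ≢ 3 + n
noStepOne-exists zero = τ , consecutive steps , λ ()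
  where
  -- 2413
  τ : Permutation′ 4
  τ = insert zero (suc zero) (insert zero (suc (suc zero)) id)
  steps : ∀ i → step τ (inject₁ i) (suc i) ≢ 1
  steps zero ()
  steps (suc zero) ()
  steps (suc (suc zero)) ()
noStepOne-exists (suc n) with τ , noOne , last ← noStepOne-exists n =
  prependMax τ , prependMax-noStepOne τ noOne last ,
  λ eq → ℕ.<⇒≢ (Finₚ.toℕ<n _) (trans (sym (prependMax-suc τ (fromℕ (3 + n)))) eq)

-- Enclosed diagonals with at least two squares

hasCount-Fin : {P : Fin n → Set} → (∀ i → Dec (P i)) →
  ∃[ m ] HasCount P m × m ≤ n × ((∀ i → P i) ⇔ n ≤ m)
hasCount-Fin {n} {P} P? =
  length (filter P? (allFin n)) ,
  (filter P? (allFin n) , Unique.filter⁺ P? (Unique.allFin⁺ n) ,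
   (λ i → mk⇔ (proj₂ ∘ ∈-filter⁻ P? {xs = allFin n}) (∈-filter⁺ P? {xs = allFin n} (∈-allFin i))) , refl) ,
  subst (length (filter P? (allFin n)) ≤_) length-allFin (Listₚ.length-filter P? (allFin n)) ,
  mk⇔ (λ all → ℕ.≤-reflexive (trans (sym length-allFin)
        (cong length (sym (Listₚ.filter-all P? {xs = allFin n} (All.tabulate λ _ → all _))))))
      λ n≤ i → [ (λ Pi → Pi) , (λ ¬Pi → contradiction n≤ (ℕ.<⇒≱
        (subst (length (filter P? (allFin n)) <_) length-allFin
          (Listₚ.filter-notAll P? (allFin n) (lose (∈-allFin i) ¬Pi))))) ] (toSum (P? i))
  where
  length-allFin : length (allFin n) ≡ n
  length-allFin = Listₚ.length-tabulate λ i → i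

-- With `P x` saying that the x-th corner of a chain is a graph point, `h` is the number of squares
-- of the enclosed chain.
FirstFailure : (ℕ → Set) → ℕ → Set
FirstFailure P h = 2 ≤ h × (∀ x → 1 ≤ x → x < h → P x) × ¬ P h

-- A linear search from 2; `b` is the remaining fuel, and `b + h` stays constant.
firstFailure : {P : ℕ → Set} → (∀ x → Dec (P x)) → P 1 → ∀ b → ¬ P (b + 2) → ∃ (FirstFailure P)
firstFailure {P} P? P₁ b = search b 2 ℕ.≤-refl λ x 1≤x x<2 → subst P (ℕ.≤-antisym 1≤x (s≤s⁻¹ x<2)) P₁
  where
  search : ∀ b h → 2 ≤ h → (∀ x → 1 ≤ x → x < h → P x) → ¬ P (b + h) → ∃ (FirstFailure P)
  search zero    h 2≤h below ¬P = h , 2≤h , below , ¬P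
  search (suc b) h 2≤h below ¬P with P? h
  ... | no ¬Ph = h , 2≤h , below , ¬Ph
  ... | yes Ph = search b (suc h) (ℕ.m≤n⇒m≤1+n 2≤h)
    (λ x 1≤x x<1+h → [ below x 1≤x , (λ { refl → Ph }) ] (ℕ.m≤n⇒m<n∨m≡n (s≤s⁻¹ x<1+h)))
    (¬P ∘ subst P (ℕ.+-suc b h))

firstFailure-unique : {P : ℕ → Set} → ∀ {h h′} → FirstFailure P h → FirstFailure P h′ → h ≡ h′
firstFailure-unique {h = h} {h′} (2≤h , below , ¬P) (2≤h′ , below′ , ¬P′) with ℕ.<-cmp h h′
... | tri< h<h′ _ _ = contradiction (below′ h (ℕ.<⇒≤ 2≤h) h<h′) ¬P
... | tri≈ _ h≡h′ _ = h≡h′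
... | tri> _ _ h′<h = contradiction (below h′ (ℕ.<⇒≤ 2≤h′) h′<h) ¬P′

module _ (π : Permutation′ k) where

  graph? : ∀ x y → Dec (Graph π x y)
  graph? x y = Finₚ.any? λ i → (x ℕ.≟ suc (toℕ i)) ×-dec (y ℕ.≟ suc (toℕ (π ⟨$⟩ʳ i)))

  -- The chain whose first graph point is that of i has its corners at
  -- (toℕ i + x , corner d i x); here x = 0 is the left extreme corner.
  startRow : Direction → Fin k → ℕ
  startRow increasing i = toℕ (π ⟨$⟩ʳ i)
  startRow decreasing i = suc (toℕ (π ⟨$⟩ʳ i))

  corner : Direction → Fin k → ℕ → ℕ
  corner increasing i x = startRow increasing i + x
  corner decreasing i x = suc (startRow decreasing i) ∸ x

  leftCorner : Direction → Fin k → ℕ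
  leftCorner increasing i = startRow increasing i
  leftCorner decreasing i = suc (startRow decreasing i)

  RunStart : Direction → Fin k → Set
  RunStart d i = ¬ Graph π (toℕ i) (leftCorner d i)

  OnRun : Direction → Fin k → ℕ → Set
  OnRun d i x = Graph π (toℕ i + x) (corner d i x)

  onRun-one : ∀ d i → OnRun d i 1
  onRun-one increasing i = i , ℕ.+-comm (toℕ i) 1 , ℕ.+-comm (toℕ (π ⟨$⟩ʳ i)) 1
  onRun-one decreasing i = i , ℕ.+-comm (toℕ i) 1 , refl

  graph-bound : ∀ {x y} → Graph π x y → x ≤ k × 1 ≤ y × y ≤ k
  graph-bound (i , refl , refl) = Finₚ.toℕ<n i , s≤s z≤n , Finₚ.toℕ<n (π ⟨$⟩ʳ i)

  run : ∀ d i → ∃ (FirstFailure (OnRun d i))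
  run d i = firstFailure (λ x → graph? (toℕ i + x) (corner d i x)) (onRun-one d i) k
    λ on → ℕ.<⇒≱ (ℕ.m<m+n k {2} (s≤s z≤n)) (ℕ.≤-trans (ℕ.m≤n+m (k + 2) (toℕ i)) (proj₁ (graph-bound on)))

  runChain : Direction → Fin k → Chain
  runChain d i = chain d (toℕ i) (startRow d i) (proj₁ (run d i))

  runChain-avoid : ∀ d i → RunStart d i → DiagonalToAvoid π (runChain d i)
  runChain-avoid increasing i start = let _ , 2≤h , on , off = run increasing i in
    2≤h ,
    (λ { zero    x<h → subst (_≤ k) (sym (ℕ.+-identityʳ (toℕ i))) (ℕ.<⇒≤ (Finₚ.toℕ<n i)) ,
                       subst (_≤ k) (sym (ℕ.+-identityʳ _)) (ℕ.<⇒≤ (Finₚ.toℕ<n (π ⟨$⟩ʳ i)))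
       ; (suc x) x<h → let x≤ , _ , y≤ = graph-bound (on (suc x) (s≤s z≤n) x<h) in x≤ , y≤ }) ,
    on , start , off
  runChain-avoid decreasing i start = let _ , 2≤h , on , off = run decreasing i in
    2≤h ,
    (λ { zero    x<h → subst (_≤ k) (sym (ℕ.+-identityʳ (toℕ i))) (ℕ.<⇒≤ (Finₚ.toℕ<n i)) , z≤n , Finₚ.toℕ<n (π ⟨$⟩ʳ i)
       -- A graph point has positive height, so the truncated subtraction is exact here.
       ; (suc x) x<h → let x≤ , 1≤y , y≤ = graph-bound (on (suc x) (s≤s z≤n) x<h) in
           x≤ , ℕ.m∸n≢0⇒n<m (ℕ.>⇒≢ 1≤y) , ℕ.≤-trans (ℕ.∸-monoˡ-≤ (suc x) (ℕ.n≤1+n _)) y≤ }) ,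
    on , start , off

  -- The corner at x = 1 is a graph point, which fixes column and row; the size is then fixed by the
  -- uniqueness of the first failure.
  avoid-runChain : ∀ c → DiagonalToAvoid π c →
    (∃ λ i → RunStart increasing i × c ≡ runChain increasing i) ⊎
    (∃ λ i → RunStart decreasing i × c ≡ runChain decreasing i)
  avoid-runChain (chain increasing col row h) (2≤h , _ , on , start , off)
    with on 1 ℕ.≤-refl 2≤h
  ... | i , col≡ , row≡ with trans (ℕ.+-comm 1 col) col≡ | trans (ℕ.+-comm 1 row) row≡
  ...   | refl | refl = inj₁ (i , start ,
    cong (chain increasing col row) (firstFailure-unique (2≤h , on , off) (proj₂ (run increasing i))))
  avoid-runChain (chain decreasing col row h) (2≤h , _ , on , start , off)
    with on 1 ℕ.≤-refl 2≤h
  ... | i , col≡ , row≡ with trans (ℕ.+-comm 1 col) col≡ | row≡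
  ...   | refl | refl = inj₂ (i , start ,
    cong (chain decreasing col row) (firstFailure-unique (2≤h , on , off) (proj₂ (run decreasing i))))

  runChain-injective : ∀ d {i j} → runChain d i ≡ runChain d j → i ≡ j
  runChain-injective d eq = Finₚ.toℕ-injective (cong Chain.col eq)

  runStart? : ∀ d i → Dec (RunStart d i)
  runStart? d i = ¬? (graph? (toℕ i) (leftCorner d i))

  diagonalCount : ℕ
  diagonalCount = proj₁ (hasCount-Fin (runStart? increasing)) + proj₁ (hasCount-Fin (runStart? decreasing))

  diagonalsToAvoid : DiagonalsToAvoid π diagonalCount
  diagonalsToAvoid = hasCount-cong
    (λ c → mk⇔
      [ (λ { (i , start , refl) → runChain-avoid increasing i start })
      , (λ { (i , start , refl) → runChain-avoid decreasing i start }) ]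
      (avoid-runChain c))
    (hasCount-⊎ (λ { c (_ , _ , refl) (_ , _ , ()) })
      (hasCount-image (runChain increasing) (runChain-injective increasing) (proj₁ (proj₂ (hasCount-Fin (runStart? increasing)))))
      (hasCount-image (runChain decreasing) (runChain-injective decreasing) (proj₁ (proj₂ (hasCount-Fin (runStart? decreasing))))))

  -- A point fails to start a chain exactly if the point one column to its left is adjacent in
  -- value. As each point starts at most one chain per direction, 2k chains occur only without such
  -- steps.
  NoStepOne⇔runStarts : NoStepOne π ⇔ (∀ d i → RunStart d i)
  NoStepOne⇔runStarts = mk⇔
    (λ { noOne increasing i (j , i≡ , πi≡) → noOne j i i≡
           (trans (cong (∣ toℕ (π ⟨$⟩ʳ j) -_∣) πi≡) (∣n-1+n∣≡1 (toℕ (π ⟨$⟩ʳ j))))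
       ; noOne decreasing i (j , i≡ , πi≡) → noOne j i i≡
           (trans (cong (∣_- toℕ (π ⟨$⟩ʳ i) ∣) (sym (ℕ.suc-injective πi≡)))
             (trans (ℕ.∣-∣-comm (suc (toℕ (π ⟨$⟩ʳ i))) (toℕ (π ⟨$⟩ʳ i))) (∣n-1+n∣≡1 (toℕ (π ⟨$⟩ʳ i))))) })
    λ starts i j j≡ one → [ (λ eq → starts increasing j (i , j≡ , sym eq))
                          , (λ eq → starts decreasing j (i , j≡ , cong suc (sym eq))) ]
                          (∣-∣≡1⇒ _ _ one)

  diagonalCount≤ : diagonalCount ≤ 2 * k
  diagonalCount≤ = let _ , _ , m≤k , _ = hasCount-Fin (runStart? increasing)
                       _ , _ , n≤k , _ = hasCount-Fin (runStart? decreasing) in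
    subst (diagonalCount ≤_) (cong (k +_) (sym (ℕ.+-identityʳ k))) (ℕ.+-mono-≤ m≤k n≤k)

  NoStepOne⇔diagonalCount : NoStepOne π ⇔ diagonalCount ≡ 2 * k
  NoStepOne⇔diagonalCount =
    let m , _ , m≤k , inc⇔ = hasCount-Fin (runStart? increasing)
        n , _ , n≤k , dec⇔ = hasCount-Fin (runStart? decreasing) in
    ⇔-trans NoStepOne⇔runStarts (mk⇔
      (λ starts → ℕ.≤-antisym diagonalCount≤ (subst (_≤ diagonalCount) (cong (k +_) (sym (ℕ.+-identityʳ k)))
        (ℕ.+-mono-≤ (to inc⇔ (starts increasing)) (to dec⇔ (starts decreasing)))))
      λ eq → let k+k≤ = ℕ.≤-reflexive (trans (cong (k +_) (sym (ℕ.+-identityʳ k))) (sym eq)) in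
        λ { increasing → from inc⇔ (ℕ.+-cancelʳ-≤ k k m (ℕ.≤-trans k+k≤ (ℕ.+-monoʳ-≤ m n≤k)))
          ; decreasing → from dec⇔ (ℕ.+-cancelˡ-≤ k k n (ℕ.≤-trans k+k≤ (ℕ.+-monoˡ-≤ n m≤k))) })

-- Occurrences

increasing-mono : {u : Fin m → Fin n} → Increasing u → ∀ {a b} → a Fin.≤ b → u a Fin.≤ u b
increasing-mono {u = u} u-inc {a} {b} a≤b with ℕ.m≤n⇒m<n∨m≡n a≤b
... | inj₁ a<b = ℕ.<⇒≤ (u-inc a<b)
... | inj₂ a≡b = ℕ.≤-reflexive (cong (toℕ ∘ u) (Finₚ.toℕ-injective a≡b))

insertAt-fromℕ-inject₁ : {A : Set} (xs : Fin n → A) (v : A) → ∀ i → Vector.insertAt xs (fromℕ n) v (inject₁ i) ≡ xs i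
insertAt-fromℕ-inject₁ xs v zero    = refl
insertAt-fromℕ-inject₁ xs v (suc i) = insertAt-fromℕ-inject₁ (xs ∘ suc) v i

framed-point : (u : Fin k → Fin n) → ∀ i → framed u (suc (inject₁ i)) ≡ suc (toℕ (u i))
framed-point {n = n} u = insertAt-fromℕ-inject₁ (λ j → suc (toℕ (u j))) (suc n)

framed-last : (u : Fin k → Fin n) → framed u (suc (fromℕ k)) ≡ suc n
framed-last {k} {n} u = Vectorₚ.insertAt-lookup (λ j → suc (toℕ (u j))) (fromℕ k) (suc n)

-- t lies between the a-th and the (a + 1)-st term of the framed sequence u.
Between : (Fin k → Fin n) → Fin (suc k) → Fin n → Set
Between u a t = (∀ j → toℕ j < toℕ a → u j Fin.< t) × (∀ j → toℕ a ≤ toℕ j → t Fin.< u j)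

framed⇒between : {u : Fin k → Fin n} → Increasing u → ∀ a {t} →
  framed u (inject₁ a) < suc (toℕ t) → suc (toℕ t) < framed u (suc a) → Between u a t
framed⇒between {k} {u = u} u-inc a {t} low high = below a low , above a high
  where
  below : ∀ a → framed u (inject₁ a) < suc (toℕ t) → ∀ j → toℕ j < toℕ a → u j Fin.< t
  below (suc i) low j (s≤s j≤i) = ℕ.≤-<-trans (increasing-mono u-inc j≤i)
    (s≤s⁻¹ (subst (_< suc (toℕ t)) (framed-point u i) low))
  above : ∀ a → suc (toℕ t) < framed u (suc a) → ∀ j → toℕ a ≤ toℕ j → t Fin.< u j
  above a high j a≤j with view a
  ... | ‵fromℕ     = contradiction (subst (_≤ toℕ j) (Finₚ.toℕ-fromℕ k) a≤j) (ℕ.<⇒≱ (Finₚ.toℕ<n j))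
  ... | ‵inject₁ i = ℕ.<-≤-trans (s≤s⁻¹ (subst (suc (toℕ t) <_) (framed-point u i) high))
    (increasing-mono u-inc (subst (_≤ toℕ j) (Finₚ.toℕ-inject₁ i) a≤j))

between⇒framed : {u : Fin k → Fin n} → ∀ a {t} → Between u a t →
  framed u (inject₁ a) < suc (toℕ t) × suc (toℕ t) < framed u (suc a)
between⇒framed {k} {n} {u} a {t} (below , above) = low a below , high
  where
  low : ∀ a → (∀ j → toℕ j < toℕ a → u j Fin.< t) → framed u (inject₁ a) < suc (toℕ t)
  low zero    _     = s≤s z≤n
  low (suc i) below = subst (_< suc (toℕ t)) (sym (framed-point u i)) (s≤s (below i ℕ.≤-refl))
  high : suc (toℕ t) < framed u (suc a)
  high with view a
  ... | ‵fromℕ     = subst (suc (toℕ t) <_) (sym (framed-last u)) (s≤s (Finₚ.toℕ<n t))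
  ... | ‵inject₁ i = subst (suc (toℕ t) <_) (sym (framed-point u i))
    (s≤s (above i (ℕ.≤-reflexive (Finₚ.toℕ-inject₁ i))))

between-punchIn : {u : Fin k → Fin (suc k)} → ∀ q → (∀ i → u i ≡ punchIn q i) → Between u q q
between-punchIn q u≡ =
  (λ j j<q → subst (Fin._< q) (sym (trans (u≡ j) (punchIn-< q j j<q))) (subst (_< toℕ q) (sym (Finₚ.toℕ-inject₁ j)) j<q)) ,
  (λ j q≤j → subst (q Fin.<_) (sym (trans (u≡ j) (punchIn-≥ q j q≤j))) (s≤s q≤j))

values : Permutation′ k → Permutation′ n → (Fin k → Fin n) → Fin k → Fin n
values π σ u b = σ ⟨$⟩ʳ u (π ⟨$⟩ˡ b)

values-⟨$⟩ʳ : (π : Permutation′ k) (σ : Permutation′ n) (u : Fin k → Fin n) →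
  ∀ i → values π σ u (π ⟨$⟩ʳ i) ≡ σ ⟨$⟩ʳ u i
values-⟨$⟩ʳ π σ u i = cong (λ i → σ ⟨$⟩ʳ u i) (inverseˡ π)

module _ {π : Permutation′ k} {σ : Permutation′ n} where

  values-increasing : (o : Occurrence π σ) → Increasing (values π σ (Occurrence.index o))
  values-increasing o {a} {b} a<b = to (Occurrence.same-order o (π ⟨$⟩ˡ a) (π ⟨$⟩ˡ b))
    (subst₂ Fin._<_ (sym (inverseʳ π)) (sym (inverseʳ π)) a<b)

  -- By trichotomy, preserving the order of the values already reflects it, so an occurrence amounts
  -- to two increasing maps.
  occurrence : (u : Fin k → Fin n) → Increasing u → Increasing (values π σ u) → Occurrence π σ
  occurrence u u-inc values-inc = record
    { index      = u
    ; increasing = u-inc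
    ; same-order = λ a b → mk⇔ (order a b) (reflect a b)
    }
    where
    order : ∀ a b → π ⟨$⟩ʳ a Fin.< π ⟨$⟩ʳ b → σ ⟨$⟩ʳ u a Fin.< σ ⟨$⟩ʳ u b
    order a b a<b = subst₂ Fin._<_ (values-⟨$⟩ʳ π σ u a) (values-⟨$⟩ʳ π σ u b) (values-inc a<b)
    reflect : ∀ a b → σ ⟨$⟩ʳ u a Fin.< σ ⟨$⟩ʳ u b → π ⟨$⟩ʳ a Fin.< π ⟨$⟩ʳ b
    reflect a b σ< with Finₚ.<-cmp (π ⟨$⟩ʳ a) (π ⟨$⟩ʳ b)
    ... | tri< a<b _ _ = a<b
    ... | tri≈ _ a≡b _ = contradiction (cong (λ i → σ ⟨$⟩ʳ u i) (⟨$⟩ʳ-injective π a≡b)) (Finₚ.<⇒≢ σ<)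
    ... | tri> _ _ b<a = contradiction (order b a b<a) (ℕ.<⇒≯ σ<)

  inSquare⇔ : (o : Occurrence π σ) → ∀ a b t → InSquare o a b t ⇔
    (Between (Occurrence.index o) a t × Between (values π σ (Occurrence.index o)) b (σ ⟨$⟩ʳ t))
  inSquare⇔ o a b t = mk⇔
    (λ (p , q , r , s) → framed⇒between (Occurrence.increasing o) a p q , framed⇒between (values-increasing o) b r s)
    (λ (p , v) → let p₁ , p₂ = between⇒framed a p ; v₁ , v₂ = between⇒framed b v in p₁ , p₂ , v₁ , v₂)

-- Nothing is said about `u i` itself, so that `t` may lie on either side of it.
Replaces : (Fin k → Fin n) → Fin k → Fin n → Set
Replaces u i t = (∀ j → j Fin.< i → u j Fin.< t) × (∀ j → i Fin.< j → t Fin.< u j)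

between-inject₁ : {u : Fin k → Fin n} → ∀ i {t} → Between u (inject₁ i) t → Replaces u i t × t Fin.< u i
between-inject₁ i (below , above) =
  ((λ j j<i → below j (subst (toℕ j <_) (sym (Finₚ.toℕ-inject₁ i)) j<i)) ,
   (λ j i<j → above j (subst (_≤ toℕ j) (sym (Finₚ.toℕ-inject₁ i)) (ℕ.<⇒≤ i<j)))) ,
  above i (ℕ.≤-reflexive (Finₚ.toℕ-inject₁ i))

between-suc : {u : Fin k → Fin n} → ∀ i {t} → Between u (suc i) t → Replaces u i t × u i Fin.< t
between-suc i (below , above) = ((λ j j<i → below j (ℕ.m≤n⇒m≤1+n j<i)) , above) , below i ℕ.≤-refl

replace : (Fin k → Fin n) → Fin k → Fin n → Fin k → Fin n
replace u i t = Vector.updateAt u i λ _ → t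

replace-increasing : {u : Fin k → Fin n} → Increasing u → ∀ i {t} → Replaces u i t → Increasing (replace u i t)
replace-increasing {u = u} u-inc i {t} (below , above) {a} {b} a<b with a Finₚ.≟ i | b Finₚ.≟ i
... | yes refl | yes refl = contradiction a<b (ℕ.<-irrefl refl)
... | yes refl | no b≢i   = subst₂ Fin._<_ (sym (Vectorₚ.updateAt-updates a u)) (sym (Vectorₚ.updateAt-minimal b a u b≢i)) (above b a<b)
... | no a≢i   | yes refl = subst₂ Fin._<_ (sym (Vectorₚ.updateAt-minimal a b u a≢i)) (sym (Vectorₚ.updateAt-updates b u)) (below a a<b)
... | no a≢i   | no b≢i   = subst₂ Fin._<_ (sym (Vectorₚ.updateAt-minimal a i u a≢i)) (sym (Vectorₚ.updateAt-minimal b i u b≢i)) (u-inc a<b)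

increasing-cong : {u v : Fin m → Fin n} → (∀ i → u i ≡ v i) → Increasing u → Increasing v
increasing-cong u≡v u-inc {a} {b} a<b = subst₂ Fin._<_ (u≡v a) (u≡v b) (u-inc a<b)

values-replace : (π : Permutation′ k) (σ : Permutation′ n) (u : Fin k → Fin n) → ∀ i t b →
  replace (values π σ u) (π ⟨$⟩ʳ i) (σ ⟨$⟩ʳ t) b ≡ values π σ (replace u i t) b
values-replace π σ u i t b with b Finₚ.≟ π ⟨$⟩ʳ i
... | yes refl = trans (Vectorₚ.updateAt-updates b (values π σ u)) (sym (trans (values-⟨$⟩ʳ π σ (replace u i t) i)
  (cong (σ ⟨$⟩ʳ_) (Vectorₚ.updateAt-updates i u))))
... | no b≢ = trans (Vectorₚ.updateAt-minimal b _ (values π σ u) b≢) (cong (σ ⟨$⟩ʳ_) (sym (Vectorₚ.updateAt-minimal (π ⟨$⟩ˡ b) i u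
  λ eq → b≢ (trans (sym (inverseʳ π)) (cong (π ⟨$⟩ʳ_) eq)))))

replaceOccurrence : {π : Permutation′ k} {σ : Permutation′ n} (o : Occurrence π σ) → ∀ i t →
  Replaces (Occurrence.index o) i t → Replaces (values π σ (Occurrence.index o)) (π ⟨$⟩ʳ i) (σ ⟨$⟩ʳ t) →
  Occurrence π σ
replaceOccurrence {π = π} {σ} o i t r-index r-values = occurrence (replace index i t)
  (replace-increasing (Occurrence.increasing o) i r-index)
  (increasing-cong (values-replace π σ index i t) (replace-increasing (values-increasing o) (π ⟨$⟩ʳ i) r-values))
  where open Occurrence o using (index)

-- Squares along one diagonal direction

Square : ℕ → Set
Square k = Fin (suc k) × Fin (suc k)

-- α i and β i are the rows of the squares of the given direction on the left
-- and on the right of the i-th point.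
module Diagonal (α β : Fin k → Fin (suc k)) where

  lower upper : Fin k → Square k
  lower i = inject₁ i , α i
  upper i = suc i , β i

  lower-injective : ∀ {i j} → lower i ≡ lower j → i ≡ j
  lower-injective = Finₚ.inject₁-injective ∘ cong proj₁

  upper-injective : ∀ {i j} → upper i ≡ upper j → i ≡ j
  upper-injective = Finₚ.suc-injective ∘ cong proj₁

  upper≡lower⇒< : ∀ {i j} → upper j ≡ lower i → j Fin.< i
  upper≡lower⇒< {i} eq = ℕ.≤-reflexive (trans (cong (toℕ ∘ proj₁) eq) (Finₚ.toℕ-inject₁ i))

  _≟ˢ_ : (s t : Square k) → Dec (s ≡ t)
  _≟ˢ_ = Product.≡-dec Finₚ._≟_ Finₚ._≟_

  Shades : Vec Letter k → Square k → Set
  Shades w s = ∃ λ i → (lookup w i ≡ lo × s ≡ lower i) ⊎ (lookup w i ≡ hi × s ≡ upper i)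

  shades? : ∀ w s → Dec (Shades w s)
  shades? w s = Finₚ.any? λ i →
    ((lookup w i ≟ᴸ lo) ×-dec (s ≟ˢ lower i)) ⊎-dec ((lookup w i ≟ᴸ hi) ×-dec (s ≟ˢ upper i))

  -- The condition of `Canonical`, with links expressed as coincidences of squares.
  Canonical′ : Vec Letter k → Set
  Canonical′ w = ∀ i j → upper j ≡ lower i → lookup w i ≡ lo → lookup w j ≡ lo

  -- A walk to the left along a chain: each `down` crosses the point `i` from its right square to
  -- its left one, also when the rows increase.
  data Slide : Square k → Square k → Set where
    stay : ∀ {s} → Slide s s
    down : ∀ {s t} i → s ≡ upper i → Slide (lower i) t → Slide s t

  module Decode (R : Square k → Set) (R? : ∀ s → Dec (R s)) where

    -- All squares before the i-th point on its chain are in R.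
    data Filled (i : Fin k) : Set where
      filled : R (lower i) → (∀ j → upper j ≡ lower i → Filled j) → Filled i

    filled? : ∀ i → Dec (Filled i)
    filled? i = go i (<-wellFounded (toℕ i))
      where
      go : ∀ i → Acc _<_ (toℕ i) → Dec (Filled i)
      go i (acc rs) = map′ (λ (r , f) → filled r f) (λ { (filled r f) → r , f })
        (R? (lower i) ×-dec Finₚ.all? previous?)
        where
        previous? : ∀ j → Dec (upper j ≡ lower i → Filled j)
        previous? j with upper j ≟ˢ lower i
        ... | no  ≢ = yes λ eq → contradiction eq ≢
        ... | yes eq = map′ (λ f _ → f) (λ f → f eq) (go j (rs (upper≡lower⇒< eq)))

    letter : {A B : Set} → Dec A → Dec B → Letter
    letter (yes _) _       = lo
    letter (no _)  (yes _) = hi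
    letter (no _)  (no _)  = none

    -- A greedy choice: up to the first square of a chain missing from R, the points shade to the
    -- left, and later points shade to the right wherever R allows. If some square of the chain is
    -- missing, all its squares in R become shaded.
    letterAt : Fin k → Letter
    letterAt i = letter (filled? i) (R? (upper i))

    word : Vec Letter k
    word = tabulate letterAt

    data LetterView (i : Fin k) : Letter → Set where
      is-lo   : Filled i → LetterView i lo
      is-hi   : ¬ Filled i → R (upper i) → LetterView i hi
      is-none : ¬ Filled i → ¬ R (upper i) → LetterView i none

    letterView : ∀ i → LetterView i (lookup word i)
    letterView i = subst (LetterView i) (sym (Vecₚ.lookup∘tabulate letterAt i)) (view-letter (filled? i) (R? (upper i)))
      where
      view-letter : (f? : Dec (Filled i)) (r? : Dec (R (upper i))) → LetterView i (letter f? r?)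
      view-letter (yes f) _       = is-lo f
      view-letter (no ¬f) (yes r) = is-hi ¬f r
      view-letter (no ¬f) (no ¬r) = is-none ¬f ¬r

    word-lo⇒filled : ∀ i → lookup word i ≡ lo → Filled i
    word-lo⇒filled i eq with lookup word i | letterView i
    word-lo⇒filled i refl | lo | is-lo f = f

    filled⇒word-lo : ∀ i → Filled i → lookup word i ≡ lo
    filled⇒word-lo i f with lookup word i | letterView i
    ... | _ | is-lo _      = refl
    ... | _ | is-hi ¬f _   = contradiction f ¬f
    ... | _ | is-none ¬f _ = contradiction f ¬f

    word-hi⇒upper : ∀ i → lookup word i ≡ hi → R (upper i)
    word-hi⇒upper i eq with lookup word i | letterView i
    word-hi⇒upper i refl | hi | is-hi _ r = r

    upper⇒word : ∀ i → R (upper i) → lookup word i ≡ hi ⊎ Filled i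
    upper⇒word i r with lookup word i | letterView i
    ... | _ | is-lo f      = inj₂ f
    ... | _ | is-hi _ _    = inj₁ refl
    ... | _ | is-none _ ¬r = contradiction r ¬r

    filled⇒lower : ∀ {i} → Filled i → R (lower i)
    filled⇒lower (filled r _) = r

    word-canonical : Canonical′ word
    word-canonical i j eq w-lo with filled _ f ← word-lo⇒filled i w-lo = filled⇒word-lo j (f j eq)

    shades⇒R : ∀ {s} → Shades word s → R s
    shades⇒R (i , inj₁ (w-lo , refl)) = filled⇒lower (word-lo⇒filled i w-lo)
    shades⇒R (i , inj₂ (w-hi , refl)) = word-hi⇒upper i w-hi

    slide-filled : ∀ {s t i} → Slide s t → s ≡ lower i → Filled i → R t
    slide-filled stay            refl f = filled⇒lower f
    slide-filled (down j eq sl) refl (filled _ f) = slide-filled sl refl (f j (sym eq))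

    -- If no preceding point shades this square with `hi`, then any preceding point is filled, hence
    -- so is `i`, which shades the square with `lo`.
    lower-shaded : ∀ {i} → R (lower i) → ¬ ¬ Shades word (lower i)
    lower-shaded {i} r unshaded = unshaded (i , inj₁ (filled⇒word-lo i (filled r previous) , refl))
      where
      previous : ∀ j → upper j ≡ lower i → Filled j
      previous j eq with upper⇒word j (subst R (sym eq) r)
      ... | inj₁ w-hi = contradiction (j , inj₂ (w-hi , sym eq)) unshaded
      ... | inj₂ f    = f

    -- This covers the right end of a chain: if the point to the left of `s` does not shade it with
    -- `hi`, that point is filled, and then R contains every square reached, including `t`.
    slide-shaded : ∀ {s t} → Slide s t → R s → ¬ R t → ¬ ¬ Shades word s
    slide-shaded stay            r ¬r _ = ¬r r
    slide-shaded (down i refl sl) r ¬r unshaded with upper⇒word i r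
    ... | inj₁ w-hi = unshaded (i , inj₂ (w-hi , refl))
    ... | inj₂ f    = ¬r (slide-filled sl refl f)

    module _ (w : Vec Letter k) (w-canonical : Canonical′ w)
             (lower⇔ : ∀ i → R (lower i) ⇔ Shades w (lower i))
             (upper⇔ : ∀ i → R (upper i) ⇔ Shades w (upper i)) where

      filled⇒lo : ∀ {i} → Filled i → lookup w i ≡ lo
      filled⇒lo {i} (filled r f) with to (lower⇔ i) r
      ... | j , inj₁ (w-lo , eq) = subst (λ i → lookup w i ≡ lo) (lower-injective (sym eq)) w-lo
      -- A point shading this square from the left precedes `i` on the chain, so it is filled and
      -- has the letter `lo` by recursion.
      ... | j , inj₂ (w-hi , eq) = case trans (sym (filled⇒lo (f j (sym eq)))) w-hi of λ ()

      lo⇒filled : ∀ i → lookup w i ≡ lo → Filled i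
      lo⇒filled i = go i (<-wellFounded (toℕ i))
        where
        go : ∀ i → Acc _<_ (toℕ i) → lookup w i ≡ lo → Filled i
        go i (acc rs) w-lo = filled (from (lower⇔ i) (i , inj₁ (w-lo , refl)))
          λ j eq → go j (rs (upper≡lower⇒< eq)) (w-canonical i j eq w-lo)

      upper⇒hi : ∀ {i} → ¬ Filled i → R (upper i) → lookup w i ≡ hi
      upper⇒hi {i} ¬f r with to (upper⇔ i) r
      -- If the next point shades the square with `lo`, canonicity forces `lo` at `i`, which makes
      -- `i` filled.
      ... | j , inj₁ (w-lo , eq) = contradiction (lo⇒filled i (w-canonical j i eq w-lo)) ¬f
      ... | j , inj₂ (w-hi , eq) = subst (λ i → lookup w i ≡ hi) (upper-injective (sym eq)) w-hi

      -- Canonicity makes the letters `lo` exactly the filled points, and the rest is then read off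
      -- the upper squares. R is compared with `w` only beside points in this direction, since a
      -- mesh also holds squares shaded in the other.
      word-unique : word ≡ w
      word-unique = trans (Vecₚ.tabulate-cong same) (Vecₚ.tabulate∘lookup w)
        where
        same : ∀ i → letterAt i ≡ lookup w i
        same i = trans (sym (Vecₚ.lookup∘tabulate letterAt i)) (by-view (letterView i) (lookup w i) refl)
          where
          by-view : ∀ {x} → LetterView i x → ∀ y → lookup w i ≡ y → x ≡ lookup w i
          by-view (is-lo f)       _    _  = sym (filled⇒lo f)
          by-view (is-hi ¬f r)    _    _  = sym (upper⇒hi ¬f r)
          by-view (is-none ¬f ¬r) lo   eq = contradiction (lo⇒filled i eq) ¬f
          by-view (is-none ¬f ¬r) hi   eq = contradiction (from (upper⇔ i) (i , inj₂ (eq , refl))) ¬r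
          by-view (is-none ¬f ¬r) none eq = sym eq

-- Meshes encoded by pairs of words

does⇒ : {P : Set} (p? : Dec P) → does p? ≡ true → P
does⇒ (yes p) _ = p

mesh-ext : {R S : Mesh k} → (∀ s → s ∈ᴹ R ⇔ s ∈ᴹ S) → R ≡ S
mesh-ext {R = R} {S} R⇔S = trans (sym (Vecₚ.tabulate∘lookup R)) (trans
  (Vecₚ.tabulate-cong λ a → Subsetₚ.⊆-antisym (λ {b} → to (R⇔S (a , b))) (λ {b} → from (R⇔S (a , b))))
  (Vecₚ.tabulate∘lookup S))

_∈ᴹ?_ : (s : Square k) (R : Mesh k) → Dec (s ∈ᴹ R)
(a , b) ∈ᴹ? R = b Subsetₚ.∈? lookup R a

inject₁≢suc : (i : Fin n) → inject₁ i ≢ suc i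
inject₁≢suc i eq = ℕ.1+n≢n (trans (sym (cong toℕ eq)) (Finₚ.toℕ-inject₁ i))

-- A weighted sum of coordinates that decreases whenever the point with letters
-- x and y moves into a square that it shades: each pair of letters allows moves
-- in at most two adjacent quadrants.
weight : Letter → Letter → (n pos val : ℕ) → ℕ
weight lo   lo   n pos val = pos
weight lo   hi   n pos val = val
weight lo   none n pos val = pos
weight hi   lo   n pos val = n ∸ val
weight hi   hi   n pos val = n ∸ pos
weight hi   none n pos val = n ∸ pos
weight none lo   n pos val = pos
weight none hi   n pos val = n ∸ pos
weight none none n pos val = 0

module _ {n p p′ v v′ : ℕ} where

  weight-lowerˡ : ∀ y → p′ < p → v′ < v → weight lo y n p′ v′ < weight lo y n p v
  weight-lowerˡ lo   p< v< = p<
  weight-lowerˡ hi   p< v< = v<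
  weight-lowerˡ none p< v< = p<

  weight-upperˡ : ∀ y → p < p′ → p′ ≤ n → v < v′ → v′ ≤ n → weight hi y n p′ v′ < weight hi y n p v
  weight-upperˡ lo   p< p≤ v< v≤ = ℕ.∸-monoʳ-< v< v≤
  weight-upperˡ hi   p< p≤ v< v≤ = ℕ.∸-monoʳ-< p< p≤
  weight-upperˡ none p< p≤ v< v≤ = ℕ.∸-monoʳ-< p< p≤

  weight-lowerʳ : ∀ x → p′ < p → v < v′ → v′ ≤ n → weight x lo n p′ v′ < weight x lo n p v
  weight-lowerʳ lo   p< v< v≤ = p<
  weight-lowerʳ hi   p< v< v≤ = ℕ.∸-monoʳ-< v< v≤
  weight-lowerʳ none p< v< v≤ = p<

  weight-upperʳ : ∀ x → p < p′ → p′ ≤ n → v′ < v → weight x hi n p′ v′ < weight x hi n p v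
  weight-upperʳ lo   p< p≤ v< = v<
  weight-upperʳ hi   p< p≤ v< = ℕ.∸-monoʳ-< p< p≤
  weight-upperʳ none p< p≤ v< = ℕ.∸-monoʳ-< p< p≤

sumWith : {A : Set} → (Fin k → A → ℕ) → (Fin k → A) → ℕ
sumWith {zero}  h u = 0
sumWith {suc k} h u = h zero (u zero) + sumWith (h ∘ suc) (u ∘ suc)

sumWith-replace-< : (h : Fin k → Fin n → ℕ) (u : Fin k → Fin n) → ∀ i {t} →
  h i t < h i (u i) → sumWith h (replace u i t) < sumWith h u
sumWith-replace-< h u zero    t< = ℕ.+-monoˡ-< (sumWith (h ∘ suc) (u ∘ suc)) t<
sumWith-replace-< h u (suc i) t< = ℕ.+-monoʳ-< (h zero (u zero)) (sumWith-replace-< (h ∘ suc) (u ∘ suc) i t<)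

module _ (π : Permutation′ k) where

  module Asc = Diagonal (λ i → inject₁ (π ⟨$⟩ʳ i)) (λ i → suc (π ⟨$⟩ʳ i))
  module Desc = Diagonal (λ i → suc (π ⟨$⟩ʳ i)) (λ i → inject₁ (π ⟨$⟩ʳ i))

  Shaded : Vec Letter k → Vec Letter k → Square k → Set
  Shaded f g s = Asc.Shades f s ⊎ Desc.Shades g s

  shaded? : ∀ f g s → Dec (Shaded f g s)
  shaded? f g s = Asc.shades? f s ⊎-dec Desc.shades? g s

  shade : Vec Letter k → Vec Letter k → Fin (suc k) → Fin (suc k) → Bool
  shade f g a b = does (shaded? f g (a , b))

  encode : Vec Letter k → Vec Letter k → Mesh k
  encode f g = tabulate λ a → tabulate (shade f g a)

  ∈-encode⇔ : ∀ f g s → s ∈ᴹ encode f g ⇔ Shaded f g s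
  ∈-encode⇔ f g (a , b) = mk⇔
    (λ s∈ → does⇒ (shaded? f g (a , b)) (trans (sym look) (Vecₚ.[]=⇒lookup s∈)))
    (λ shaded → Vecₚ.lookup⇒[]= b _ (trans look (dec-true (shaded? f g (a , b)) shaded)))
    where
    look : lookup (lookup (encode f g) a) b ≡ does (shaded? f g (a , b))
    look = trans (cong (λ row → lookup row b) (Vecₚ.lookup∘tabulate (λ a → tabulate (shade f g a)) a)) (Vecₚ.lookup∘tabulate (shade f g a) b)

  private
    AscCorner DescCorner : Square k → Set
    AscCorner s = ∃ λ i → s ≡ Asc.lower i ⊎ s ≡ Asc.upper i
    DescCorner s = ∃ λ i → s ≡ Desc.lower i ⊎ s ≡ Desc.upper i

    -- Corners from different diagonals of a square share a side, so two graph points there would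
    -- agree in position or in value. This makes the two words of a mesh independent of each other.
    separate : ∀ {s} → AscCorner s → DescCorner s → ⊥
    separate (i , inj₁ refl) (j , inj₁ eq) with refl ← Finₚ.inject₁-injective (cong proj₁ eq) =
      inject₁≢suc (π ⟨$⟩ʳ i) (cong proj₂ eq)
    separate (i , inj₁ refl) (j , inj₂ eq) with refl ← ⟨$⟩ʳ-injective π (Finₚ.inject₁-injective (cong proj₂ eq)) =
      inject₁≢suc i (cong proj₁ eq)
    separate (i , inj₂ refl) (j , inj₁ eq) with refl ← ⟨$⟩ʳ-injective π (Finₚ.suc-injective (cong proj₂ eq)) =
      inject₁≢suc i (sym (cong proj₁ eq))
    separate (i , inj₂ refl) (j , inj₂ eq) with refl ← Finₚ.suc-injective (cong proj₁ eq) =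
      inject₁≢suc (π ⟨$⟩ʳ i) (sym (cong proj₂ eq))

  encode-asc⇔ : ∀ f g {s} → AscCorner s → s ∈ᴹ encode f g ⇔ Asc.Shades f s
  encode-asc⇔ f g {s} corner = ⇔-trans (∈-encode⇔ f g s) (mk⇔
    [ (λ shades → shades) , (λ (i , shades) → ⊥-elim (separate corner (i , Sum.map proj₂ proj₂ shades))) ] inj₁)

  encode-desc⇔ : ∀ f g {s} → DescCorner s → s ∈ᴹ encode f g ⇔ Desc.Shades g s
  encode-desc⇔ f g {s} corner = ⇔-trans (∈-encode⇔ f g s) (mk⇔
    [ (λ (i , shades) → ⊥-elim (separate (i , Sum.map proj₂ proj₂ shades) corner)) , (λ shades → shades) ] inj₂)

  module AscWord (R : Mesh k) = Asc.Decode (_∈ᴹ R) (_∈ᴹ? R)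
  module DescWord (R : Mesh k) = Desc.Decode (_∈ᴹ R) (_∈ᴹ? R)

  decode-encode : ∀ f g → Asc.Canonical′ f → Desc.Canonical′ g →
    AscWord.word (encode f g) ≡ f × DescWord.word (encode f g) ≡ g
  decode-encode f g f-canonical g-canonical =
    AscWord.word-unique (encode f g) f f-canonical
      (λ i → encode-asc⇔ f g (i , inj₁ refl)) (λ i → encode-asc⇔ f g (i , inj₂ refl)) ,
    DescWord.word-unique (encode f g) g g-canonical
      (λ i → encode-desc⇔ f g (i , inj₁ refl)) (λ i → encode-desc⇔ f g (i , inj₂ refl))

  -- Moving occurrences out of the shaded squares

  module _ (f g : Vec Letter k) {σ : Permutation′ n} where

    pointWeight : Fin k → Fin n → ℕ
    pointWeight i t = weight (lookup f i) (lookup g i) n (toℕ t) (toℕ (σ ⟨$⟩ʳ t))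

    move : (o : Occurrence π σ) → ∀ s t → Shaded f g s → InSquare o (proj₁ s) (proj₂ s) t →
      ∃ λ (o′ : Occurrence π σ) → sumWith pointWeight (Occurrence.index o′) < sumWith pointWeight (Occurrence.index o)
    move o (a , b) t shaded in-square with to (inSquare⇔ o a b t) in-square
    ... | between-pos , between-val = shift shaded
      where
      open Occurrence o using (index)
      Decreases : Letter → Letter → Fin k → Set
      Decreases x y i = weight x y n (toℕ t) (toℕ (σ ⟨$⟩ʳ t)) < weight x y n (toℕ (index i)) (toℕ (σ ⟨$⟩ʳ index i))
      replaced : ∀ i → Replaces index i t → Replaces (values π σ index) (π ⟨$⟩ʳ i) (σ ⟨$⟩ʳ t) →
        Decreases (lookup f i) (lookup g i) i →
        ∃ λ (o′ : Occurrence π σ) → sumWith pointWeight (Occurrence.index o′) < sumWith pointWeight index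
      replaced i r-pos r-val t< = replaceOccurrence o i t r-pos r-val , sumWith-replace-< pointWeight index i t<
      shift : Shaded f g (a , b) →
        ∃ λ (o′ : Occurrence π σ) → sumWith pointWeight (Occurrence.index o′) < sumWith pointWeight index
      shift (inj₁ (i , inj₁ (f-lo , refl))) =
        let r-pos , p< = between-inject₁ i between-pos
            r-val , v< = between-inject₁ (π ⟨$⟩ʳ i) between-val in
        replaced i r-pos r-val (subst (λ x → Decreases x (lookup g i) i) (sym f-lo)
          (weight-lowerˡ (lookup g i) p< (subst (σ ⟨$⟩ʳ t Fin.<_) (values-⟨$⟩ʳ π σ index i) v<)))
      shift (inj₁ (i , inj₂ (f-hi , refl))) =
        let r-pos , p< = between-suc i between-pos
            r-val , v< = between-suc (π ⟨$⟩ʳ i) between-val in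
        replaced i r-pos r-val (subst (λ x → Decreases x (lookup g i) i) (sym f-hi)
          (weight-upperˡ (lookup g i) p< (ℕ.<⇒≤ (Finₚ.toℕ<n t))
            (subst (Fin._< σ ⟨$⟩ʳ t) (values-⟨$⟩ʳ π σ index i) v<) (ℕ.<⇒≤ (Finₚ.toℕ<n (σ ⟨$⟩ʳ t)))))
      shift (inj₂ (i , inj₁ (g-lo , refl))) =
        let r-pos , p< = between-inject₁ i between-pos
            r-val , v< = between-suc (π ⟨$⟩ʳ i) between-val in
        replaced i r-pos r-val (subst (λ y → Decreases (lookup f i) y i) (sym g-lo)
          (weight-lowerʳ (lookup f i) p< (subst (Fin._< σ ⟨$⟩ʳ t) (values-⟨$⟩ʳ π σ index i) v<) (ℕ.<⇒≤ (Finₚ.toℕ<n (σ ⟨$⟩ʳ t)))))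
      shift (inj₂ (i , inj₂ (g-hi , refl))) =
        let r-pos , p< = between-suc i between-pos
            r-val , v< = between-inject₁ (π ⟨$⟩ʳ i) between-val in
        replaced i r-pos r-val (subst (λ y → Decreases (lookup f i) y i) (sym g-hi)
          (weight-upperʳ (lookup f i) p< (ℕ.<⇒≤ (Finₚ.toℕ<n t)) (subst (σ ⟨$⟩ʳ t Fin.<_) (values-⟨$⟩ʳ π σ index i) v<)))

  -- An occurrence of least weight would have empty shaded squares. Well-founded descent refutes
  -- every occurrence directly, without choosing a least one.
  encode-superfluous : ∀ f g → Superfluous π (encode f g)
  encode-superfluous f g n σ = mk⇔
    (λ avoids o → descend avoids o (<-wellFounded _))
    (λ avoids (o , _) → avoids o)
    where
    descend : AvoidsMesh π (encode f g) σ → (o : Occurrence π σ) →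
      Acc _<_ (sumWith (pointWeight f g {σ = σ}) (Occurrence.index o)) → ⊥
    descend avoids o (acc rs) = avoids (o , λ a b s∈ (t , in-square) →
      let o′ , o′< = move f g o (a , b) t (to (∈-encode⇔ f g (a , b)) s∈) in-square in
      descend avoids o′ (rs o′<))

-- Superfluous meshes contain no enclosed diagonals

module _ (α β : Fin k → Fin (suc k)) where
  open Diagonal α β

  slide-along : (s : Fin (suc k) → Fin (suc k)) → ∀ q a →
    (∀ i → toℕ q ≤ toℕ i → toℕ i < toℕ a → s (suc i) ≡ β i × s (inject₁ i) ≡ α i) →
    toℕ q ≤ toℕ a → Slide (a , s a) (q , s q)
  slide-along s q a linked q≤a = <-weakInduction
    (λ m → toℕ q ≤ toℕ m → toℕ m ≤ toℕ a → Slide (m , s m) (q , s q)) base next a q≤a ℕ.≤-refl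
    where
    base : toℕ q ≤ 0 → 0 ≤ toℕ a → Slide (zero , s zero) (q , s q)
    base q≤0 _ = subst (λ q → Slide (zero , s zero) (q , s q)) (Finₚ.toℕ-injective (sym (ℕ.n≤0⇒n≡0 q≤0))) stay
    next : ∀ i → (toℕ q ≤ toℕ (inject₁ i) → toℕ (inject₁ i) ≤ toℕ a → Slide (inject₁ i , s (inject₁ i)) (q , s q)) →
      toℕ q ≤ suc (toℕ i) → suc (toℕ i) ≤ toℕ a → Slide (suc i , s (suc i)) (q , s q)
    next i ih q≤ i<a with ℕ.m≤n⇒m<n∨m≡n q≤
    ... | inj₂ q≡ = subst (λ m → Slide (m , s m) (q , s q)) (Finₚ.toℕ-injective {i = q} {j = suc i} q≡) stay
    ... | inj₁ (s≤s q≤i) = let upper≡ , lower≡ = linked i q≤i i<a in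
      down i (cong (suc i ,_) upper≡) (subst (λ r → Slide (inject₁ i , r) (q , s q)) lower≡
        (ih (subst (toℕ q ≤_) (sym (Finₚ.toℕ-inject₁ i)) q≤i)
            (subst (_≤ toℕ a) (sym (Finₚ.toℕ-inject₁ i)) (ℕ.<⇒≤ i<a))))

punchIn-cases : ∀ (v : Fin (suc n)) j →
  (toℕ j < toℕ v × punchIn v j ≡ inject₁ j) ⊎ (toℕ v ≤ toℕ j × punchIn v j ≡ suc j)
punchIn-cases v j with toℕ j ℕ.<? toℕ v
... | yes j<v = inj₁ (j<v , punchIn-< v j j<v)
... | no  j≮v = inj₂ (ℕ.≮⇒≥ j≮v , punchIn-≥ v j (ℕ.≮⇒≥ j≮v))

inject₁-below : ∀ {a q : Fin (suc n)} → a Fin.< q → ∃[ i ] a ≡ inject₁ i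
inject₁-below {a = a} a<q with view a
... | ‵fromℕ     = contradiction (Finₚ.≤fromℕ _) (ℕ.<⇒≱ a<q)
... | ‵inject₁ i = i , refl

module _ (π : Permutation′ k) where

  -- Only deletable points to the left are reached by a slide. One to the right already shows that
  -- `s` is the left square of a point, and `lower-shaded` then suffices.
  Reaches : Square k → Square k → Set
  Reaches s t = ((∃ λ i → s ≡ Asc.lower π i) ⊎ (∃ λ i → s ≡ Desc.lower π i)) ⊎
                (Asc.Slide π s t ⊎ Desc.Slide π s t)

  -- Deleting the point (a , s a) or the point (q , s q) of s leaves π.
  same-deletion : (s : Permutation′ (suc k)) → ∀ a q →
    (∀ i → s ⟨$⟩ʳ punchIn a i ≡ punchIn (s ⟨$⟩ʳ a) (π ⟨$⟩ʳ i)) →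
    (∀ i → s ⟨$⟩ʳ punchIn q i ≡ punchIn (s ⟨$⟩ʳ q) (π ⟨$⟩ʳ i)) →
    Reaches (a , s ⟨$⟩ʳ a) (q , s ⟨$⟩ʳ q)
  same-deletion s a q delete-a delete-q with Finₚ.<-cmp a q
  ... | tri≈ _ refl _ = inj₂ (inj₁ Diagonal.stay)
  -- Column `a` survives the deletion of a later column as column `i` of π, so its value is that of
  -- `π ⟨$⟩ʳ i` or one more.
  ... | tri< a<q _ _ with i , refl ← inject₁-below a<q
    with punchIn-cases (s ⟨$⟩ʳ q) (π ⟨$⟩ʳ i)
       | trans (cong (s ⟨$⟩ʳ_) (sym (punchIn-< q i (subst (_< toℕ q) (Finₚ.toℕ-inject₁ i) a<q)))) (delete-q i)
  ...   | inj₁ (_ , eq) | sa≡ = inj₁ (inj₁ (i , cong (inject₁ i ,_) (trans sa≡ eq)))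
  ...   | inj₂ (_ , eq) | sa≡ = inj₁ (inj₂ (i , cong (inject₁ i ,_) (trans sa≡ eq)))
  same-deletion s a q delete-a delete-q | tri> _ a≢q q<a = inj₂ (by-values (Finₚ.<-cmp (s ⟨$⟩ʳ q) (s ⟨$⟩ʳ a)))
    where
    s-suc : ∀ i → toℕ q ≤ toℕ i → s ⟨$⟩ʳ suc i ≡ punchIn (s ⟨$⟩ʳ q) (π ⟨$⟩ʳ i)
    s-suc i q≤i = trans (cong (s ⟨$⟩ʳ_) (sym (punchIn-≥ q i q≤i))) (delete-q i)
    s-inject₁ : ∀ i → toℕ i < toℕ a → s ⟨$⟩ʳ inject₁ i ≡ punchIn (s ⟨$⟩ʳ a) (π ⟨$⟩ʳ i)
    s-inject₁ i i<a = trans (cong (s ⟨$⟩ʳ_) (sym (punchIn-< a i i<a))) (delete-a i)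
    distinct : ∀ i {x} → s ⟨$⟩ʳ suc i ≡ x → s ⟨$⟩ʳ inject₁ i ≢ x
    distinct i suc≡ inj≡ = inject₁≢suc i (⟨$⟩ʳ-injective s (trans inj≡ (sym suc≡)))
    by-values : _ → Asc.Slide π (a , s ⟨$⟩ʳ a) (q , s ⟨$⟩ʳ q) ⊎ Desc.Slide π (a , s ⟨$⟩ʳ a) (q , s ⟨$⟩ʳ q)
    by-values (tri≈ _ eq _) = contradiction (sym (⟨$⟩ʳ-injective s eq)) a≢q
    by-values (tri< v<b _ _) = inj₁ (slide-along _ _ (s ⟨$⟩ʳ_) q a linked (ℕ.<⇒≤ q<a))
      where
      linked : ∀ i → toℕ q ≤ toℕ i → toℕ i < toℕ a →
        s ⟨$⟩ʳ suc i ≡ suc (π ⟨$⟩ʳ i) × s ⟨$⟩ʳ inject₁ i ≡ inject₁ (π ⟨$⟩ʳ i)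
      -- Between `q` and `a` both neighbouring values of `s` are `π ⟨$⟩ʳ i` or one more. They differ
      -- by injectivity, and the order of the two deleted values decides which is larger.
      linked i q≤i i<a with punchIn-cases (s ⟨$⟩ʳ q) (π ⟨$⟩ʳ i) | punchIn-cases (s ⟨$⟩ʳ a) (π ⟨$⟩ʳ i)
      ... | inj₂ (_ , eq) | inj₁ (_ , eq′) = trans (s-suc i q≤i) eq , trans (s-inject₁ i i<a) eq′
      ... | inj₁ (_ , eq) | inj₁ (_ , eq′) = contradiction (trans (s-inject₁ i i<a) eq′) (distinct i (trans (s-suc i q≤i) eq))
      ... | inj₂ (_ , eq) | inj₂ (_ , eq′) = contradiction (trans (s-inject₁ i i<a) eq′) (distinct i (trans (s-suc i q≤i) eq))
      ... | inj₁ (j<v , _) | inj₂ (b≤j , _) = contradiction (ℕ.<-trans j<v v<b) (ℕ.≤⇒≯ b≤j)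
    by-values (tri> _ _ b<v) = inj₂ (slide-along _ _ (s ⟨$⟩ʳ_) q a linked (ℕ.<⇒≤ q<a))
      where
      linked : ∀ i → toℕ q ≤ toℕ i → toℕ i < toℕ a →
        s ⟨$⟩ʳ suc i ≡ inject₁ (π ⟨$⟩ʳ i) × s ⟨$⟩ʳ inject₁ i ≡ suc (π ⟨$⟩ʳ i)
      linked i q≤i i<a with punchIn-cases (s ⟨$⟩ʳ q) (π ⟨$⟩ʳ i) | punchIn-cases (s ⟨$⟩ʳ a) (π ⟨$⟩ʳ i)
      ... | inj₁ (_ , eq) | inj₂ (_ , eq′) = trans (s-suc i q≤i) eq , trans (s-inject₁ i i<a) eq′
      ... | inj₁ (_ , eq) | inj₁ (_ , eq′) = contradiction (trans (s-inject₁ i i<a) eq′) (distinct i (trans (s-suc i q≤i) eq))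
      ... | inj₂ (_ , eq) | inj₂ (_ , eq′) = contradiction (trans (s-inject₁ i i<a) eq′) (distinct i (trans (s-suc i q≤i) eq))
      ... | inj₂ (v≤j , _) | inj₁ (j<b , _) = contradiction (ℕ.<-trans j<b b<v) (ℕ.≤⇒≯ v≤j)

  -- Positions and values of the occurrence each skip one element. The skipped value belongs to the
  -- skipped position, and this single remaining point fixes the occupied square.
  occurrence-deletion : (s : Permutation′ (suc k)) (o : Occurrence π s) → ∃ λ q →
    (∀ i → s ⟨$⟩ʳ punchIn q i ≡ punchIn (s ⟨$⟩ʳ q) (π ⟨$⟩ʳ i)) × InSquare o q (s ⟨$⟩ʳ q) q
  occurrence-deletion s o = q , deletion ,
    from (inSquare⇔ o q (s ⟨$⟩ʳ q) q) (between-punchIn q index≡ ,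
      subst (λ v → Between (values π s index) v (s ⟨$⟩ʳ q)) (sym sq≡v)
        (subst (Between (values π s index) v) (sym sq≡v) (between-punchIn v values≡)))
    where
    open Occurrence o using (index)
    position = increasing-punchIn index (Occurrence.increasing o)
    value = increasing-punchIn (values π s index) (values-increasing o)
    q v : Fin (suc k)
    q = proj₁ position
    v = proj₁ value
    index≡ : ∀ i → index i ≡ punchIn q i
    index≡ = proj₂ position
    values≡ : ∀ b → values π s index b ≡ punchIn v b
    values≡ = proj₂ value
    s-punchIn : ∀ i → s ⟨$⟩ʳ punchIn q i ≡ punchIn v (π ⟨$⟩ʳ i)
    s-punchIn i = trans (cong (s ⟨$⟩ʳ_) (sym (index≡ i)))
      (trans (sym (values-⟨$⟩ʳ π s index i)) (values≡ (π ⟨$⟩ʳ i)))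
    sq≡v : s ⟨$⟩ʳ q ≡ v
    sq≡v with q Finₚ.≟ (s ⟨$⟩ˡ v)
    ... | yes q≡ = trans (cong (s ⟨$⟩ʳ_) q≡) (inverseʳ s)
    ... | no q≢ = contradiction
      (trans (sym (s-punchIn (punchOut q≢))) (trans (cong (s ⟨$⟩ʳ_) (Finₚ.punchIn-punchOut q≢)) (inverseʳ s)))
      (Finₚ.punchInᵢ≢i v _)
    deletion : ∀ i → s ⟨$⟩ʳ punchIn q i ≡ punchIn (s ⟨$⟩ʳ q) (π ⟨$⟩ʳ i)
    deletion i = trans (s-punchIn i) (cong (λ v → punchIn v (π ⟨$⟩ʳ i)) (sym sq≡v))

  insert-self : ∀ a b → insert a b π ⟨$⟩ʳ a ≡ b
  insert-self a b with a Finₚ.≟ a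
  ... | yes _  = refl
  ... | no a≢a = contradiction refl a≢a

  punchIn-increasing : ∀ (q : Fin (suc n)) → Increasing (punchIn q)
  punchIn-increasing q {a} {b} a<b = ℕ.≤∧≢⇒< (Finₚ.punchIn-mono-≤ q a b (ℕ.<⇒≤ a<b))
    λ eq → Finₚ.<⇒≢ a<b (Finₚ.punchIn-injective q a b (Finₚ.toℕ-injective eq))

  insert-contains : ∀ a b → Contains π (insert a b π)
  insert-contains a b = occurrence (punchIn a) (punchIn-increasing a)
    (increasing-cong (λ i → sym (trans (insert-punchIn a b π (π ⟨$⟩ˡ i)) (cong (punchIn b) (inverseʳ π))))
      (punchIn-increasing b))

  -- Inserting a point into the square s gives a permutation whose occurrences
  -- of π all have a point in a square t reached from s.
  superfluous-reaches : ∀ R → Superfluous π R → ∀ s → ¬ (∀ t → Reaches s t → t ∈ᴹ R)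
  superfluous-reaches R superfluous (a , b) all-in = to (superfluous (suc k) σ) avoids (insert-contains a b)
    where
    σ : Permutation′ (suc k)
    σ = insert a b π
    avoids : AvoidsMesh π R σ
    avoids (o , empty) = let q , deletion , in-square = occurrence-deletion σ o in
      empty q (σ ⟨$⟩ʳ q) (all-in (q , σ ⟨$⟩ʳ q) (subst (λ b → Reaches (a , b) (q , σ ⟨$⟩ʳ q)) (insert-self a b)
        (same-deletion σ a q
          (λ i → trans (insert-punchIn a b π i) (cong (λ v → punchIn v (π ⟨$⟩ʳ i)) (sym (insert-self a b))))
          deletion)))
        (q , in-square)

  encode-decode : ∀ R → Superfluous π R → encode π (AscWord.word π R) (DescWord.word π R) ≡ R
  encode-decode R superfluous = mesh-ext λ s → ⇔-trans (∈-encode⇔ π (AscWord.word π R) (DescWord.word π R) s) (mk⇔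
    [ AscWord.shades⇒R π R , DescWord.shades⇒R π R ] (shaded s))
    where
    shaded : ∀ s → s ∈ᴹ R → Shaded π (AscWord.word π R) (DescWord.word π R) s
    shaded s s∈ with shaded? π (AscWord.word π R) (DescWord.word π R) s
    ... | yes shades  = shades
    ... | no unshaded = ⊥-elim (superfluous-reaches R superfluous s λ t → reached t)
      where
      reached : ∀ t → Reaches s t → t ∈ᴹ R
      reached t reaches with t ∈ᴹ? R
      ... | yes t∈ = t∈
      ... | no t∉ = ⊥-elim (absurd reaches)
        where
        absurd : ¬ Reaches s t
        absurd (inj₁ (inj₁ (i , refl))) = AscWord.lower-shaded π R s∈ (unshaded ∘ inj₁)
        absurd (inj₁ (inj₂ (i , refl))) = DescWord.lower-shaded π R s∈ (unshaded ∘ inj₂)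
        absurd (inj₂ (inj₁ slide))      = AscWord.slide-shaded π R slide s∈ t∉ (unshaded ∘ inj₁)
        absurd (inj₂ (inj₂ slide))      = DescWord.slide-shaded π R slide s∈ t∉ (unshaded ∘ inj₂)

-- The value of sup-mesh

-- Comparing columns, squares of two points can coincide in this way only for consecutive points,
-- which leaves the equation of rows.
canonical⇔ : (α β : Fin (suc n) → Fin (suc (suc n))) (linked? : ∀ (i : Fin n) → Dec (β (inject₁ i) ≡ α (suc i))) →
  ∀ w → Canonical (λ i → does (linked? i)) w ⇔ Diagonal.Canonical′ α β w
canonical⇔ α β linked? w = mk⇔
  (λ canonical i j eq → consecutive {P = λ j i → upper j ≡ lower i → lookup w i ≡ lo → lookup w j ≡ lo}
    (λ i eq → canonical i (dec-true (linked? i) (cong proj₂ eq))) j i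
    (sym (trans (cong (toℕ ∘ proj₁) eq) (Finₚ.toℕ-inject₁ i))) eq)
  (λ canonical i linked → canonical (suc i) (inject₁ i) (cong (suc (inject₁ i) ,_) (does⇒ (linked? i) linked)))
  where
  open Diagonal α β

module _ (π : Permutation′ (suc n)) where

  ascent? : ∀ i → Dec (Ascent π i)
  ascent? i = _ Finₚ.≟ _

  descent? : ∀ i → Dec (Descent π i)
  descent? i = _ Finₚ.≟ _

  ascends descends : Fin n → Bool
  ascends i = does (ascent? i)
  descends i = does (descent? i)

  supMesh : SupMesh π (wordCount ascends * wordCount descends)
  supMesh = hasCount-transfer (λ (f , g) → encode π f g) (λ R → AscWord.word π R , DescWord.word π R)
    (λ (f , g) _ → encode-superfluous π f g)
    (λ (f , g) (cf , cg) → let eq , eq′ = decode-encode π f g (to (inc⇔ f) cf) (to (dec⇔ g) cg) in cong₂ _,_ eq eq′)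
    (λ R _ → from (inc⇔ (AscWord.word π R)) (AscWord.word-canonical π R) , from (dec⇔ (DescWord.word π R)) (DescWord.word-canonical π R))
    (λ R → encode-decode π R)
    (hasCount-× (hasCount-canonical ascends) (hasCount-canonical descends))
    where
    inc⇔ = canonical⇔ _ _ ascent?
    dec⇔ = canonical⇔ _ _ descent?

-- Extremal values of sup-mesh

module _ (π : Permutation′ (suc n)) where

  meshCount : ℕ
  meshCount = wordCount (ascends π) * wordCount (descends π)

  ascends-descends-exclusive : Exclusive (ascends π) (descends π)
  ascends-descends-exclusive i asc desc = ℕ.<-asym
    (subst (toℕ (π ⟨$⟩ʳ inject₁ i) <_) (Finₚ.toℕ-inject₁ _) (ℕ.≤-reflexive (cong toℕ (does⇒ (ascent? π i) asc))))
    (subst (toℕ (π ⟨$⟩ʳ suc i) <_) (Finₚ.toℕ-inject₁ _) (ℕ.≤-reflexive (sym (cong toℕ (does⇒ (descent? π i) desc)))))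

  leastCount≤meshCount : leastCount n ≤ meshCount
  leastCount≤meshCount = leastCount≤ _ _ ascends-descends-exclusive

  meshCount≡leastCount : AllStepsOne π → meshCount ≡ leastCount n
  meshCount≡leastCount all = [ by-ascents , by-descents ] (ascents-or-descents π (to (AllStepsOne⇔ π) all))
    where
    by-ascents : (∀ i → Ascent π i) → meshCount ≡ leastCount n
    by-ascents asc = cong₂ _*_
      (proj₁ (all-linked-counts (ascends π) all-ascends))
      (wordCount-all-unlinked (descends π) λ i → dec-false (descent? π i) λ desc →
        ascends-descends-exclusive i (all-ascends i) (dec-true (descent? π i) desc))
      where
      all-ascends : ∀ i → ascends π i ≡ true
      all-ascends i = dec-true (ascent? π i) (asc i)
    by-descents : (∀ i → Descent π i) → meshCount ≡ leastCount n
    by-descents desc = trans (cong₂ _*_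
      (wordCount-all-unlinked (ascends π) λ i → dec-false (ascent? π i) λ asc →
        ascends-descends-exclusive i (dec-true (ascent? π i) asc) (all-descends i))
      (proj₁ (all-linked-counts (descends π) all-descends)))
      (ℕ.*-comm (freeCount n) (runCount n))
      where
      all-descends : ∀ i → descends π i ≡ true
      all-descends i = dec-true (descent? π i) (desc i)

  meshCount≤leastCount⇒AllStepsOne : meshCount ≤ leastCount n → AllStepsOne π
  meshCount≤leastCount⇒AllStepsOne ≤least = from (AllStepsOne⇔ π) one-step
    where
    one-step : ∀ i → Ascent π i ⊎ Descent π i
    one-step i with ascent? π i in asc | descent? π i in desc
    ... | yes a | _     = inj₁ a
    ... | no _  | yes d = inj₂ d
    ... | no _  | no _  = contradiction ≤least (ℕ.<⇒≱
      (leastCount< _ _ ascends-descends-exclusive i (cong does asc) (cong does desc)))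

  meshCount≤freeCount² : meshCount ≤ freeCount n * freeCount n
  meshCount≤freeCount² = ℕ.*-mono-≤ (wordCount≤freeCount (ascends π)) (wordCount≤freeCount (descends π))

  meshCount≡freeCount² : NoStepOne π → meshCount ≡ freeCount n * freeCount n
  meshCount≡freeCount² noOne = let steps = to (NoStepOne⇔ π) noOne in cong₂ _*_
    (wordCount-all-unlinked (ascends π) λ i → dec-false (ascent? π i) (proj₁ (steps i)))
    (wordCount-all-unlinked (descends π) λ i → dec-false (descent? π i) (proj₂ (steps i)))

  freeCount²≤meshCount⇒NoStepOne : freeCount n * freeCount n ≤ meshCount → NoStepOne π
  freeCount²≤meshCount⇒NoStepOne free≤ = from (NoStepOne⇔ π) λ i →
    (λ asc → ℕ.<⇒≱ (ℕ.≤-<-trans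
      (ℕ.*-monoʳ-≤ (wordCount (ascends π)) (wordCount≤freeCount (descends π)))
      (ℕ.*-monoˡ-< (freeCount n) ⦃ >-nonZero (0<freeCount n) ⦄
        (wordCount<freeCount (ascends π) i (dec-true (ascent? π i) asc)))) free≤) ,
    (λ desc → ℕ.<⇒≱ (ℕ.≤-<-trans
      (ℕ.*-monoˡ-≤ (wordCount (descends π)) (wordCount≤freeCount (ascends π)))
      (ℕ.*-monoʳ-< (freeCount n) ⦃ >-nonZero (0<freeCount n) ⦄
        (wordCount<freeCount (descends π) i (dec-true (descent? π i) desc)))) free≤)


-- The numbers inside `SupMeshMinimized` and `SupMeshMaximized` are arbitrary witnesses; this
-- identifies them with `meshCount`.
supMesh-unique : (π : Permutation′ (suc n)) → SupMesh π m → meshCount π ≡ m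
supMesh-unique π = hasCount-unique {P = Superfluous π} (supMesh π)

SupMeshMinimized⇒AllStepsOne : (π τ : Permutation′ (suc n)) → AllStepsOne τ → SupMeshMinimized π → AllStepsOne π
SupMeshMinimized⇒AllStepsOne {n} π τ all (m , count , least) =
  let m′ , count′ , m≤m′ = least τ in
  meshCount≤leastCount⇒AllStepsOne π (begin
    meshCount π      ≡⟨ supMesh-unique π count ⟩
    m                ≤⟨ m≤m′ ⟩
    m′               ≡⟨ supMesh-unique τ count′ ⟨
    meshCount τ      ≡⟨ meshCount≡leastCount τ all ⟩
    leastCount n     ∎)
  where open ℕ.≤-Reasoning

AllStepsOne⇒SupMeshMinimized : (π : Permutation′ (suc n)) → AllStepsOne π → SupMeshMinimized π
AllStepsOne⇒SupMeshMinimized π all = meshCount π , supMesh π , λ τ → meshCount τ , supMesh τ ,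
  ℕ.≤-trans (ℕ.≤-reflexive (meshCount≡leastCount π all)) (leastCount≤meshCount τ)

NoStepOne⇒SupMeshMaximized : (π : Permutation′ (suc n)) → NoStepOne π → SupMeshMaximized π
NoStepOne⇒SupMeshMaximized π noOne = meshCount π , supMesh π , λ τ → meshCount τ , supMesh τ ,
  ℕ.≤-trans (meshCount≤freeCount² τ) (ℕ.≤-reflexive (sym (meshCount≡freeCount² π noOne)))

SupMeshMaximized⇒NoStepOne : (π τ : Permutation′ (suc n)) → NoStepOne τ → SupMeshMaximized π → NoStepOne π
SupMeshMaximized⇒NoStepOne {n} π τ noOne (m , count , greatest) =
  let m′ , count′ , m′≤m = greatest τ in
  freeCount²≤meshCount⇒NoStepOne π (begin
    freeCount n * freeCount n    ≡⟨ meshCount≡freeCount² τ noOne ⟨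
    meshCount τ                  ≡⟨ supMesh-unique τ count′ ⟩
    m′                           ≤⟨ m′≤m ⟩
    m                            ≡⟨ supMesh-unique π count ⟨
    meshCount π                  ∎)
  where open ℕ.≤-Reasoning

-- In sizes 2 and 3 every permutation has a step of size one, so there the upper bound by
-- `freeCount` is not attained.
noStepOne-permutation : ∀ n → suc n ≢ 2 → suc n ≢ 3 → ∃ (NoStepOne {suc n})
noStepOne-permutation zero                ≢2 ≢3 = id , λ { zero zero () }
noStepOne-permutation (suc zero)          ≢2 ≢3 = contradiction refl ≢2
noStepOne-permutation (suc (suc zero))    ≢2 ≢3 = contradiction refl ≢3
noStepOne-permutation (suc (suc (suc n))) ≢2 ≢3 = let τ , noOne , _ = noStepOne-exists n in τ , noOne

corollary5p4 : ∀ (k : ℕ) .{{_ : NonZero k}} (π : Permutation′ k) →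
    ((SupMeshMinimized π ⇔ AllStepsOne π) ×
    (AllStepsOne π ⇔ (π ≈ id ⊎ π ≈ reverse))) ×
    ((NoStepOne π → SupMeshMaximized π) ×
    (k ≢ 2 → k ≢ 3 → SupMeshMaximized π → NoStepOne π) ×
    (NoStepOne π ⇔ DiagonalsToAvoid π (2 * k)) ×
    (∃[ d ] DiagonalsToAvoid π d × d ≤ 2 * k))
corollary5p4 (suc n) π =
  -- The identity serves as a permutation attaining `leastCount`.
  (mk⇔ (SupMeshMinimized⇒AllStepsOne π id (from (AllStepsOne⇔id⊎reverse id) (inj₁ λ _ → refl)))
       (AllStepsOne⇒SupMeshMinimized π) ,
   AllStepsOne⇔id⊎reverse π) ,
  NoStepOne⇒SupMeshMaximized π ,
  (λ ≢2 ≢3 maximized → let τ , noOne = noStepOne-permutation n ≢2 ≢3 in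
    SupMeshMaximized⇒NoStepOne π τ noOne maximized) ,
  ⇔-trans (NoStepOne⇔diagonalCount π) (mk⇔
    (λ eq → subst (DiagonalsToAvoid π) eq (diagonalsToAvoid π))
    (hasCount-unique {P = DiagonalToAvoid π} (diagonalsToAvoid π))) ,
  diagonalCount π , diagonalsToAvoid π , diagonalCount≤ π
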